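{- Let $\mathbb{F}$ be a field. Let $K$ be a simplicial complex whose vertices are partitioned into $m+1$ subsets $V_0,\ldots,V_m$ and such that $\widetilde{H}_{m-1}(K,\mathbb{F})=0$. Let $k$ be an integer such that $-1\le k\le m-1$. Suppose that for every $S\subseteq\{0,\ldots,m\}$: (1) $\widetilde{H}_{k-|S|}\big(K_{\{0,\ldots,m\}\setminus S},\mathbb{F}\big)=0$ whenever $1\le|S|\le k+1$; (2) $\widetilde{H}_{|S|-2}\big(\tilde K_S,\mathbb{F}\big)=0$ whenever $k+2\le|S|\le m$. Then $K$ contains a rainbow simplex.
   Context: Simplicial complexes are abstract and the empty set is not a simplex, so the minimal dimension of a simplex is $0$. $\widetilde{H}$ denotes reduced simplicial homology; $\widetilde{H}_{ -1}(Y,\mathbb{F})=0$ if and only if $Y$ is nonempty. The sets $V_0,\ldots,V_m$ are viewed as colours: a vertex in $V_i$ has colour $i$. For $S\subseteq\{0,\ldots,m\}$, $K_S$ is the subcomplex of $K$ induced by the vertices in $\bigcup_{i\in S}V_i$ (all simplices of $K$ whose vertices all lie in $\bigcup_{i\in S}V_i$), and $\tilde K_S$ is the subcomplex of $K$ consisting of those simplices $\sigma$ of $K$ such that the set of colours of the vertices of $\sigma$ does not contain $S$. A rainbow simplex is a simplex of $K$ that has exactly one vertex in each $V_i$, $i=0,\ldots,m$. -}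

module Defs where

open import Level using (Level; _⊔_) renaming (suc to lsuc)
open import Algebra.Apartness.Bundles using (HeytingField)
open import Data.Fin.Base using (Fin; toℕ)
open import Data.Fin.Subset using (Subset) renaming (_∈_ to _∈ˢ_)
open import Data.Integer.Base using (ℤ; +_; -[1+_])
open import Data.List.Base using (List; []; _∷_; map; concatMap; tabulate)
open import Data.List.Membership.Propositional using (_∈_)
open import Data.List.Relation.Binary.Subset.Propositional using (_⊆_)
open import Data.List.Relation.Binary.Subset.Propositional.Properties using (map⁺)
open import Data.List.Relation.Unary.All using (All)
open import Data.Nat.Base using (ℕ; zero; suc)
open import Data.Product.Base using (_×_; _,_; ∃-syntax)
open import Data.Product using (∃!)
open import Data.Unit.Polymorphic.Base using (⊤)
open import Data.Vec.Base using (Vec; []; _∷_; removeAt; toList)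
open import Data.Vec.Relation.Unary.Unique.Propositional using (Unique)
open import Relation.Binary.PropositionalEquality.Core using (_≡_; _≢_)
open import Relation.Nullary.Negation.Core using (¬_)

private variable
  v s c ℓ₁ ℓ₂ : Level
  n : ℕ

-- A finite set of vertices is given by any list enumerating it.  Closure under
-- _⊆_ (inclusion of the underlying sets) makes IsSimplex independent of the
-- order and the multiplicities of the enumeration.  The vertices of the complex
-- are the x with IsSimplex (x ∷ []); not every element of V has to be one, so
-- that subcomplexes live on the same V.
record SimplicialComplex (V : Set v) (s : Level) : Set (v ⊔ lsuc s) where
  field
    IsSimplex : List V → Set s
    nonempty  : ∀ {σ} → IsSimplex σ → σ ≢ []
    face      : ∀ {σ τ} → IsSimplex τ → σ ⊆ τ → σ ≢ [] → IsSimplex σ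

open SimplicialComplex public

-- The colour classes are the fibres of colour.
module _ {V : Set v} {m : ℕ} (K : SimplicialComplex V s) (colour : V → Fin (suc m)) where

  -- K_S
  induced : Subset (suc m) → SimplicialComplex V (v ⊔ s)
  induced S .IsSimplex σ = IsSimplex K σ × (∀ {x} → x ∈ σ → colour x ∈ˢ S)
  induced S .nonempty (p , _) = nonempty K p
  induced S .face (p , q) σ⊆τ σ≢[] = face K p σ⊆τ σ≢[] , λ x∈σ → q (σ⊆τ x∈σ)

  -- K̃_S
  avoiding : Subset (suc m) → SimplicialComplex V s
  avoiding S .IsSimplex σ = IsSimplex K σ × ¬ (∀ {i} → i ∈ˢ S → i ∈ map colour σ)
  avoiding S .nonempty (p , _) = nonempty K p
  avoiding S .face (p , q) σ⊆τ σ≢[] =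
    face K p σ⊆τ σ≢[] , λ S⊆σ → q (λ i∈S → map⁺ colour σ⊆τ (S⊆σ i∈S))

  IsRainbow : List V → Set (v ⊔ s)
  IsRainbow σ = IsSimplex K σ × (∀ i → ∃! _≡_ (λ x → x ∈ σ × colour x ≡ i))

-- HeytingField is the library's notion of field: x # y means that x - y is
-- invertible, and tightness says that only 0# fails to be apart from 0#.
-- Classically these are exactly the fields.
module Homology (𝔽 : HeytingField c ℓ₁ ℓ₂) (V : Set v) where

  open HeytingField 𝔽 using (Carrier; _≈_; _+_; _*_; -_; 0#; 1#)

  -- Chains are graded by the number of vertices: Chain n contains the chains
  -- of degree n - 1.
  Chain : ℕ → Set (c ⊔ v)
  Chain n = List (Carrier × Vec V n)

  -- Adjacent transpositions generate all reorderings, each with its sign.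
  data _⇄_ : Vec V n → Vec V n → Set v where
    here  : ∀ {x y} {xs : Vec V n} → (x ∷ y ∷ xs) ⇄ (y ∷ x ∷ xs)
    there : ∀ {x} {xs ys : Vec V n} → xs ⇄ ys → (x ∷ xs) ⇄ (x ∷ ys)

  infix 4 _≋_ _⇄_ _ChainOf_

  -- Equality of formal sums in the vector space generated by the tuples of
  -- vertices, modulo σ = - τ when τ is an odd permutation of σ.
  data _≋_ {n} : Chain n → Chain n → Set (c ⊔ ℓ₁ ⊔ v) where
    ≋-refl   : ∀ {z} → z ≋ z
    ≋-sym    : ∀ {z w} → z ≋ w → w ≋ z
    ≋-trans  : ∀ {z w u} → z ≋ w → w ≋ u → z ≋ u
    ∷-cong   : ∀ {a b σ z w} → a ≈ b → z ≋ w → (a , σ) ∷ z ≋ (b , σ) ∷ w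
    exchange : ∀ {s t z} → s ∷ t ∷ z ≋ t ∷ s ∷ z
    merge    : ∀ {a b σ z} → (a , σ) ∷ (b , σ) ∷ z ≋ (a + b , σ) ∷ z
    drop     : ∀ {σ z} → (0# , σ) ∷ z ≋ z
    orient   : ∀ {a σ τ z} → σ ⇄ τ → (a , σ) ∷ z ≋ (- a , τ) ∷ z

  scale : Carrier → Chain n → Chain n
  scale a = map (λ (b , σ) → a * b , σ)

  sign : ℕ → Carrier
  sign zero    = 1#
  sign (suc i) = - sign i

  ∂-tuple : Vec V (suc n) → Chain n
  ∂-tuple σ = tabulate (λ i → sign (toℕ i) , removeAt σ i)

  ∂ : Chain (suc n) → Chain n
  ∂ = concatMap (λ (a , σ) → scale a (∂-tuple σ))

  IsCycle : Chain n → Set (c ⊔ ℓ₁ ⊔ v)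
  IsCycle {zero}  z = ⊤
  IsCycle {suc n} z = ∂ z ≋ []

  -- The empty tuple is the generator in degree -1 of the augmented complex.
  IsOrientedSimplex : SimplicialComplex V s → Vec V n → Set (v ⊔ s)
  IsOrientedSimplex K []        = ⊤
  IsOrientedSimplex K σ@(_ ∷ _) = Unique σ × IsSimplex K (toList σ)

  -- The relations of _≋_ preserve the multiset of entries of a tuple, so the
  -- chains satisfying _ChainOf K form, up to _≋_, the oriented chain group of K.
  _ChainOf_ : Chain n → SimplicialComplex V s → Set (c ⊔ v ⊔ s)
  z ChainOf K = All (λ (_ , σ) → IsOrientedSimplex K σ) z

  CyclesBound : ℕ → SimplicialComplex V s → Set (c ⊔ ℓ₁ ⊔ v ⊔ s)
  CyclesBound n K = ∀ (z : Chain n) → z ChainOf K → IsCycle z →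
                    ∃[ w ] w ChainOf K × ∂ w ≋ z

-- H̃ d K 𝔽 = 0
H̃-vanishes : ℤ → {V : Set v} → SimplicialComplex V s → HeytingField c ℓ₁ ℓ₂ →
             Set (c ⊔ ℓ₁ ⊔ v ⊔ s)
H̃-vanishes (+ d)          {V} K 𝔽 = Homology.CyclesBound 𝔽 V (suc d) K
H̃-vanishes -[1+ zero ]    {V} K 𝔽 = Homology.CyclesBound 𝔽 V zero K
H̃-vanishes -[1+ (suc _) ] {V} K 𝔽 = ⊤

module Submission where

-- Put q = k + 2.  Pairs (S , T) of disjoint sets of colours index chains E(S , T) with |T| vertices,
-- which vanish unless |S| = max(q - |T|, 0) (except that, for T empty, E(S , ∅) is the empty simplex
-- for every |S| ≥ q) and which satisfy
--   ∂E(S , T) = ∑ ± E(S ∪ j , T ∖ j) - ∑ ± E(S , T ∖ j),   the sums being over j ∈ T.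
-- Hypothesis (1) provides E(S , T) in K_{Sᶜ} for S nonempty, hypothesis (2) and the vanishing of
-- H̃_{m-1}(K) provide E(∅ , T) in K̃_T and E(∅ , {0,…,m}) in K.
--
-- Let P(S , T ; B) count with signs the simplices of E(S , T) whose colours are exactly B.  It vanishes
-- if B meets S.  As counting turns ∂ into a contraction, a Hopf trace argument shows that
-- ∑_T P(∅ , T ; T) does not change when S = ∅ is replaced by S = {0} and T, B by subsets of {1,…,m},
-- and so on until |S| = q, where the sum is 1.  For T ≠ {0,…,m} the term P(∅ , T ; T) is 0 since
-- E(∅ , T) lies in K̃_T, so E(∅ , {0,…,m}) contains a rainbow simplex.

open import Defs
open import Level using (Level; _⊔_)
open import Algebra.Apartness.Bundles using (HeytingField; HeytingCommutativeRing)
open import Algebra.Bundles using (AbelianGroup; CommutativeRing)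
open import Data.Empty using (⊥-elim)
open import Data.Fin.Base using (Fin; zero; suc; toℕ)
import Data.Fin.Properties as Fin
open import Data.Fin.Subset using (Subset; Side; inside; outside; ∁; ∣_∣; ⊤; ⊥) renaming (_∈_ to _∈ˢ_; _∉_ to _∉ˢ_)
open import Data.Fin.Subset.Properties using (∉⊥; ∣⊥∣≡0; ∈⊤; ∣p∣≤n; x∈p⇒∣p-x∣<∣p∣; x∉p⇒x∈∁p; x∈∁p⇒x∉p)
open import Data.List.Base using (List; []; _∷_; _++_; map; tabulate)
open import Data.List.Membership.Propositional using (_∈_)
open import Data.List.Membership.Propositional.Properties using (∈-map⁻; ∈-map⁺)
open import Data.List.Properties using (++-assoc; ++-identityʳ; map-++)
open import Data.List.Relation.Unary.All as All using (All; []; _∷_)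
open import Data.List.Relation.Unary.Any as Any using ()
open import Data.Nat.Base as ℕ using (ℕ; zero; suc; pred; _∸_; z≤n; s≤s; s<s; s<s⁻¹)
import Data.Nat.Properties as ℕ
open import Data.Product.Base using (_×_; _,_; ∃-syntax; proj₁; proj₂)
open import Data.Product using (∃!)
open import Data.Sum.Base using (_⊎_; inj₁; inj₂)
open import Data.Unit.Polymorphic.Base using (tt)
open import Data.Vec.Base as Vec using (Vec; []; _∷_; removeAt; toList; here; there; _[_]≔_)
open import Data.Vec.Properties using ([]=-injective; []≔-updates; []≔-minimal)
open import Function.Base using (_∘_)
open import Relation.Binary.Definitions using (tri<; tri≈; tri>)
open import Relation.Binary.PropositionalEquality as ≡ using (_≡_; _≢_; cong)
open import Relation.Nullary using (¬_; Dec; yes; no; contradiction; _×-dec_)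

private variable
  a a′ c ℓ ℓ′ ℓ₁ ℓ₂ p s s′ v : Level
  n N : ℕ

-- Markings and their elementary steps.

-- A marking describes a pair (S , T): T is the set of chosen colours, and S the set of colours
-- settled as inside.
data Mark : Set where
  chosen  : Mark
  settled : Side → Mark

isChosen isExcluded : Mark → Side
isChosen chosen      = inside
isChosen (settled _) = outside
isExcluded chosen      = outside
isExcluded (settled s) = s

Marking : ℕ → Set
Marking = Vec Mark

T-of S-of : Marking n → Subset n
T-of = Vec.map isChosen
S-of = Vec.map isExcluded

#T #S : Marking n → ℕ
#T w = ∣ T-of w ∣
#S w = ∣ S-of w ∣

choose : Side → Mark
choose inside  = chosen
choose outside = settled outside

-- The marking of `(∅ , A)`. These markings index the diagonal of the trace.
choosing : Subset n → Marking n
choosing = Vec.map choose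

-- The two kinds of terms in the boundary formula: an `inside` step leads to `(S ∪ j , T ∖ j)`, an
-- `outside` step to `(S , T ∖ j)`.
data _⟶[_]_ : Marking n → Side → Marking n → Set where
  here  : ∀ {b} {w : Marking n} → (chosen ∷ w) ⟶[ b ] (settled b ∷ w)
  there : ∀ {b x} {w w′ : Marking n} → w ⟶[ b ] w′ → (x ∷ w) ⟶[ b ] (x ∷ w′)

⟶-#T : ∀ {b} {w w′ : Marking n} → w ⟶[ b ] w′ → #T w ≡ suc (#T w′)
⟶-#T here                      = ≡.refl
⟶-#T (there {x = chosen} s)    = cong suc (⟶-#T s)
⟶-#T (there {x = settled _} s) = ⟶-#T s

drop-S : {w w′ : Marking n} → w ⟶[ outside ] w′ → S-of w′ ≡ S-of w
drop-S here              = ≡.refl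
drop-S (there {x = x} s) = cong (isExcluded x ∷_) (drop-S s)

drop-T : {w w′ : Marking n} → w ⟶[ outside ] w′ → ∀ {i} → i ∈ˢ T-of w′ → i ∈ˢ T-of w
drop-T here                   (there i∈) = there i∈
drop-T (there {x = chosen} s) here       = here
drop-T (there s)              (there i∈) = there (drop-T s i∈)

exclude-#S : {w w′ : Marking n} → w ⟶[ inside ] w′ → #S w′ ≡ suc (#S w)
exclude-#S here                            = ≡.refl
exclude-#S (there {x = chosen} s)          = exclude-#S s
exclude-#S (there {x = settled outside} s) = exclude-#S s
exclude-#S (there {x = settled inside} s)  = cong suc (exclude-#S s)

exclude-S : {w w′ : Marking n} → w ⟶[ inside ] w′ → ∀ {i} → i ∈ˢ S-of w → i ∈ˢ S-of w′
exclude-S here                           (there i∈) = there i∈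
exclude-S (there {x = settled inside} s) here       = here
exclude-S (there s)                      (there i∈) = there (exclude-S s i∈)

exclude-∈ : {w w′ : Marking n} → w ⟶[ inside ] w′ → ∃[ i ] i ∈ˢ T-of w × i ∈ˢ S-of w′
exclude-∈ here      = zero , here , here
exclude-∈ (there s) with i , i∈T , i∈S ← exclude-∈ s = suc i , there i∈T , there i∈S

T-choosing : (A : Subset n) → T-of (choosing A) ≡ A
T-choosing []            = ≡.refl
T-choosing (inside ∷ A)  = cong (inside ∷_) (T-choosing A)
T-choosing (outside ∷ A) = cong (outside ∷_) (T-choosing A)

S-choosing : (A : Subset n) → S-of (choosing A) ≡ ⊥
S-choosing []            = ≡.refl
S-choosing (inside ∷ A)  = cong (outside ∷_) (S-choosing A)
S-choosing (outside ∷ A) = cong (outside ∷_) (S-choosing A)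

-- Identities for differences in an abelian group.

module Differences (G : AbelianGroup a ℓ) where
  open AbelianGroup G
  open import Algebra.Properties.AbelianGroup G
  open import Algebra.Properties.CommutativeSemigroup commutativeSemigroup
  open import Relation.Binary.Reasoning.Setoid setoid

  //-cong : ∀ {x y u v} → x ≈ y → u ≈ v → x - u ≈ y - v
  //-cong p q = ∙-cong p (⁻¹-cong q)

  x-ε : ∀ x → x - ε ≈ x
  x-ε x = trans (∙-congˡ ε⁻¹≈ε) (identityʳ x)

  //-zero : ∀ {x y} → x ≈ ε → y ≈ ε → x - y ≈ ε
  //-zero p q = trans (//-cong p q) (x-ε ε)

  x-y≈ε⇒y≈ε : ∀ {x y} → x - y ≈ ε → x ≈ ε → y ≈ ε
  x-y≈ε⇒y≈ε {x} {y} p q = trans (sym (x∙y⁻¹≈ε⇒x≈y x y p)) q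

  ∙-zero : ∀ {x y} → x ≈ ε → y ≈ ε → x ∙ y ≈ ε
  ∙-zero p q = trans (∙-cong p q) (identityˡ ε)

  ⁻¹-zero : ∀ {x} → x ≈ ε → x ⁻¹ ≈ ε
  ⁻¹-zero p = trans (⁻¹-cong p) ε⁻¹≈ε

  [x-y]⁻¹ : ∀ x y → (x - y) ⁻¹ ≈ y - x
  [x-y]⁻¹ = ⁻¹-anti-homo-//

  x-[x-y] : ∀ x y → x - (x - y) ≈ y
  x-[x-y] x y = begin
    x - (x - y)    ≈⟨ ∙-congˡ ([x-y]⁻¹ x y) ⟩
    x ∙ (y - x)    ≈⟨ assoc x y _ ⟨
    x ∙ y - x      ≈⟨ xyx⁻¹≈y x y ⟩
    y              ∎

  [x-y]∙y : ∀ x y → (x - y) ∙ y ≈ x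
  [x-y]∙y x y = trans (assoc x _ y) (trans (∙-congˡ (inverseˡ y)) (identityʳ x))

  //-interchange : ∀ x y u v → (x - y) - (u - v) ≈ (x - u) - (y - v)
  //-interchange x y u v = begin
    (x - y) - (u - v)           ≈⟨ ∙-congˡ (⁻¹-∙-comm u (v ⁻¹)) ⟨
    (x - y) ∙ (u ⁻¹ ∙ v ⁻¹ ⁻¹)  ≈⟨ interchange x (y ⁻¹) (u ⁻¹) _ ⟩
    (x - u) ∙ (y ⁻¹ ∙ v ⁻¹ ⁻¹)  ≈⟨ ∙-congˡ (⁻¹-∙-comm y (v ⁻¹)) ⟩
    (x - u) - (y - v)           ∎

  cross : ∀ x y u v → (x - (y - u)) ∙ (y - (x - v)) ≈ u ∙ v
  cross x y u v = begin
    (x - (y - u)) ∙ (y - (x - v))  ≈⟨ ∙-cong (∙-congˡ ([x-y]⁻¹ y u)) (∙-congˡ ([x-y]⁻¹ x v)) ⟩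
    (x ∙ (u - y)) ∙ (y ∙ (v - x))  ≈⟨ ∙-cong (assoc x u _) (assoc y v _) ⟨
    ((x ∙ u) - y) ∙ ((y ∙ v) - x)  ≈⟨ ∙-cong (∙-congʳ (comm x u)) (∙-congʳ (comm y v)) ⟩
    ((u ∙ x) - y) ∙ ((v ∙ y) - x)  ≈⟨ ∙-cong (assoc u x _) (assoc v y _) ⟩
    (u ∙ (x - y)) ∙ (v ∙ (y - x))  ≈⟨ interchange u (x - y) v (y - x) ⟩
    (u ∙ v) ∙ ((x - y) ∙ (y - x))  ≈⟨ ∙-congˡ (∙-congˡ ([x-y]⁻¹ x y)) ⟨
    (u ∙ v) ∙ ((x - y) - (x - y))  ≈⟨ ∙-congˡ (inverseʳ (x - y)) ⟩
    (u ∙ v) ∙ ε                    ≈⟨ identityʳ _ ⟩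
    u ∙ v                          ∎

-- Alternating sums over markings.

module Moves (G : AbelianGroup a ℓ) where
  open import Data.Nat.Base using (_<_)
  open AbelianGroup G
  open import Algebra.Properties.AbelianGroup G
  open import Relation.Binary.Reasoning.Setoid setoid
  open Differences G

  private
    Family : ℕ → Set a
    Family n = Marking n → Carrier

  -- The alternating sum, over the chosen colours, of the results of settling that colour.
  move : Side → Family n → Family n
  move b X []              = ε
  move b X (chosen ∷ w)    = X (settled b ∷ w) - move b (X ∘ (chosen ∷_)) w
  move b X (settled s ∷ w) = move b (X ∘ (settled s ∷_)) w

  -- A general predicate lets one induction serve both for vanishing and for lying in a subcomplex.
  move-closed : (P : Carrier → Set p) → P ε → (∀ {x y} → P x → P y → P (x - y)) →
                ∀ b (X : Family n) w → (∀ {w′} → w ⟶[ b ] w′ → P (X w′)) → P (move b X w)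
  move-closed P Pε P- b X []              Q = Pε
  move-closed P Pε P- b X (chosen ∷ w)    Q = P- (Q here) (move-closed P Pε P- b _ w (Q ∘ there))
  move-closed P Pε P- b X (settled s ∷ w) Q = move-closed P Pε P- b _ w (Q ∘ there)

  move-zero : ∀ b (X : Family n) w → (∀ {w′} → w ⟶[ b ] w′ → X w′ ≈ ε) → move b X w ≈ ε
  move-zero = move-closed (_≈ ε) refl //-zero

  move-cong : ∀ b (X Y : Family n) w → (∀ {w′} → w ⟶[ b ] w′ → X w′ ≈ Y w′) →
              move b X w ≈ move b Y w
  move-cong b X Y []              e = refl
  move-cong b X Y (chosen ∷ w)    e = //-cong (e here) (move-cong b _ _ w (e ∘ there))
  move-cong b X Y (settled s ∷ w) e = move-cong b _ _ w (e ∘ there)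

  move-sub : ∀ b (X Y : Family n) w → move b (λ u → X u - Y u) w ≈ move b X w - move b Y w
  move-sub b X Y []              = sym (x-ε ε)
  move-sub b X Y (chosen ∷ w)    =
    trans (∙-congˡ (⁻¹-cong (move-sub b _ _ w))) (//-interchange _ _ _ _)
  move-sub b X Y (settled s ∷ w) = move-sub b _ _ w

  -- Settling two colours on the same side gives the same marking in either order, with opposite
  -- signs.
  move-move : ∀ b (X : Family n) w → move b (move b X) w ≈ ε
  move-move b X []              = refl
  move-move b X (settled s ∷ w) = move-move b _ w
  move-move b X (chosen ∷ w)    = begin
    move b (X ∘ (settled b ∷_)) w -
      move b (λ u → X (settled b ∷ u) - move b (X ∘ (chosen ∷_)) u) w
      ≈⟨ ∙-congˡ (⁻¹-cong (move-sub b _ _ w)) ⟩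
    move b (X ∘ (settled b ∷_)) w -
      (move b (X ∘ (settled b ∷_)) w - move b (move b (X ∘ (chosen ∷_))) w)
      ≈⟨ x-[x-y] _ _ ⟩
    move b (move b (X ∘ (chosen ∷_))) w
      ≈⟨ move-move b _ w ⟩
    ε ∎

  -- Settling `i` on side `b` and `j` on side `c` occurs in both double sums, with opposite signs as
  -- the order differs.
  move-anticomm : ∀ b c (X : Family n) w → move b (move c X) w ∙ move c (move b X) w ≈ ε
  move-anticomm b c X []              = identityˡ ε
  move-anticomm b c X (settled s ∷ w) = move-anticomm b c _ w
  move-anticomm b c X (chosen ∷ w)    =
    trans (∙-cong (//-cong refl (move-sub b _ _ w)) (//-cong refl (move-sub c _ _ w)))
          (trans (cross _ _ _ _) (move-anticomm b c _ w))

  -- A step lowers `#T` by one whichever side it takes.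
  move-#T : ∀ b c (f : ℕ → Carrier) (w : Marking n) → move b (f ∘ #T) w ≈ move c (f ∘ #T) w
  move-#T b c f []              = refl
  move-#T b c f (chosen ∷ w)    = //-cong refl (move-#T b c (f ∘ suc) w)
  move-#T b c f (settled s ∷ w) = move-#T b c f w

  -- `𝒟 E` is the right-hand side of the boundary formula.
  δ κ 𝒟 : Family n → Family n
  δ = move outside
  κ = move inside
  𝒟 X w = κ X w - δ X w

  𝒟-zero : (X : Family n) (w : Marking n) →
           (∀ {w′} → w ⟶[ inside ] w′ → X w′ ≈ ε) →
           (∀ {w′} → w ⟶[ outside ] w′ → X w′ ≈ ε) → 𝒟 X w ≈ ε
  𝒟-zero X w p q = //-zero (move-zero inside X w p) (move-zero outside X w q)

  -- Both `κ` and `δ` square to zero, and they anticommute.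
  𝒟-𝒟 : (X : Family n) (w : Marking n) → 𝒟 (𝒟 X) w ≈ ε
  𝒟-𝒟 X w = begin
    𝒟 (𝒟 X) w
      ≈⟨ //-cong (move-sub inside (κ X) (δ X) w) (move-sub outside (κ X) (δ X) w) ⟩
    (κ (κ X) w - κ (δ X) w) - (δ (κ X) w - δ (δ X) w)
      ≈⟨ //-interchange _ _ _ _ ⟩
    (κ (κ X) w - δ (κ X) w) - (κ (δ X) w - δ (δ X) w)
      ≈⟨ //-cong (trans (∙-congʳ (move-move inside X w)) (identityˡ _))
                (trans (//-cong refl (move-move outside X w)) (x-ε _)) ⟩
    δ (κ X) w ⁻¹ - κ (δ X) w
      ≈⟨ ⁻¹-∙-comm _ _ ⟩
    (δ (κ X) w ∙ κ (δ X) w) ⁻¹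
      ≈⟨ ⁻¹-zero (move-anticomm outside inside X w) ⟩
    ε ∎

  -- The cone over the first colour that is not excluded: a contracting homotopy for δ.
  h : Family n → Family n
  h X []                    = ε
  h X (chosen ∷ w)          = ε
  h X (settled outside ∷ w) = X (chosen ∷ w)
  h X (settled inside ∷ w)  = h (X ∘ (settled inside ∷_)) w

  -- `h X w` is `ε` or a single value of `X`, so `P` may be any predicate holding at `ε`, such as
  -- being a cycle.
  h-closed : (P : Carrier → Set p) → P ε → ∀ (X : Family n) w →
             (∀ {w′} → w′ ⟶[ outside ] w → P (X w′)) → P (h X w)
  h-closed P Pε X []                    Q = Pε
  h-closed P Pε X (chosen ∷ w)          Q = Pε
  h-closed P Pε X (settled outside ∷ w) Q = Q here
  h-closed P Pε X (settled inside ∷ w)  Q = h-closed P Pε _ w (Q ∘ there)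

  -- The bound on `#S w` supplies an apex for the cone, a colour that is not excluded.
  δ-h : (X : Family n) (w : Marking n) → #S w < n → δ (h X) w ∙ h (δ X) w ≈ X w
  δ-h X (settled outside ∷ w) _ = trans (comm _ _) ([x-y]∙y _ _)
  δ-h X (settled inside ∷ w)  p = δ-h _ w (s<s⁻¹ p)
  δ-h X (chosen ∷ w)          _ = trans (identityʳ _)
    (trans (//-cong refl (move-zero outside _ w (λ _ → refl))) (x-ε _))

module _ (G : AbelianGroup a ℓ) (H : AbelianGroup a′ ℓ′) where
  private
    module G = AbelianGroup G
    module H = AbelianGroup H
    module MG = Moves G
    module MH = Moves H
  open Differences H

  move-homo : (f : G.Carrier → H.Carrier) → f G.ε H.≈ H.ε →
              (∀ x y → f (x G.- y) H.≈ f x H.- f y) →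
              ∀ b (X : Marking n → G.Carrier) w → f (MG.move b X w) H.≈ MH.move b (f ∘ X) w
  move-homo f fε f- b X []              = fε
  move-homo f fε f- b X (chosen ∷ w)    =
    H.trans (f- _ _) (//-cong H.refl (move-homo f fε f- b _ w))
  move-homo f fε f- b X (settled s ∷ w) = move-homo f fε f- b _ w

-- Exterior algebra on the colours and the trace argument.

module Forms (G : AbelianGroup a ℓ) where
  open import Data.Nat.Base using (_<_; _≤_)
  open AbelianGroup G
  open import Algebra.Properties.AbelianGroup G
  open import Algebra.Properties.CommutativeSemigroup commutativeSemigroup using (interchange)
  open import Relation.Binary.Reasoning.Setoid setoid
  open Differences G
  open Moves G

  -- Elements of the exterior algebra over G on n generators, by coordinates.
  Form : ℕ → Set a
  Form n = Subset n → Carrier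

  -- Contraction with the functional taking every generator to 1.
  ι : Form n → Form n
  ι X []            = ε
  ι X (outside ∷ B) = X (inside ∷ B) ∙ ι (X ∘ (outside ∷_)) B
  ι X (inside ∷ B)  = ι (X ∘ (inside ∷_)) B ⁻¹

  -- Contraction at `B` only reads sets with one element more. The size condition is there for
  -- `matrix`, where the number of vertices of the chain depends on the set.
  ι-cong : ∀ (X Y : Form n) B → (∀ B′ → ∣ B′ ∣ ≡ suc ∣ B ∣ → X B′ ≈ Y B′) → ι X B ≈ ι Y B
  ι-cong X Y []            e = refl
  ι-cong X Y (outside ∷ B) e = ∙-cong (e _ ≡.refl) (ι-cong _ _ B (λ B′ → e (outside ∷ B′)))
  ι-cong X Y (inside ∷ B)  e = ⁻¹-cong (ι-cong _ _ B (λ B′ p → e (inside ∷ B′) (cong suc p)))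

  ι-zero : ∀ (X : Form n) B → (∀ B′ → X B′ ≈ ε) → ι X B ≈ ε
  ι-zero X []            z = refl
  ι-zero X (outside ∷ B) z = ∙-zero (z _) (ι-zero _ B (λ B′ → z (outside ∷ B′)))
  ι-zero X (inside ∷ B)  z = ⁻¹-zero (ι-zero _ B (λ B′ → z (inside ∷ B′)))

  ι-⁻¹ : ∀ (X : Form n) B → ι (λ B′ → X B′ ⁻¹) B ≈ ι X B ⁻¹
  ι-⁻¹ X []            = sym ε⁻¹≈ε
  ι-⁻¹ X (outside ∷ B) = trans (∙-congˡ (ι-⁻¹ _ B)) (⁻¹-∙-comm _ _)
  ι-⁻¹ X (inside ∷ B)  = ⁻¹-cong (ι-⁻¹ _ B)

  ι-∙ : ∀ (X Y : Form n) B → ι (λ B′ → X B′ ∙ Y B′) B ≈ ι X B ∙ ι Y B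
  ι-∙ X Y []            = sym (identityˡ ε)
  ι-∙ X Y (outside ∷ B) = trans (∙-congˡ (ι-∙ _ _ B)) (interchange _ _ _ _)
  ι-∙ X Y (inside ∷ B)  = trans (⁻¹-cong (ι-∙ _ _ B)) (sym (⁻¹-∙-comm _ _))

  -- Left multiplication by the generator i.
  wedge : Fin n → Form n → Form n
  wedge zero    X (outside ∷ B) = ε
  wedge zero    X (inside ∷ B)  = X (outside ∷ B)
  wedge (suc i) X (outside ∷ B) = wedge i (X ∘ (outside ∷_)) B
  wedge (suc i) X (inside ∷ B)  = wedge i (X ∘ (inside ∷_)) B ⁻¹

  wedge-cong : ∀ i (X Y : Form n) B → (∀ B′ → X B′ ≈ Y B′) → wedge i X B ≈ wedge i Y B
  wedge-cong zero    X Y (outside ∷ B) e = refl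
  wedge-cong zero    X Y (inside ∷ B)  e = e _
  wedge-cong (suc i) X Y (outside ∷ B) e = wedge-cong i _ _ B (λ B′ → e (outside ∷ B′))
  wedge-cong (suc i) X Y (inside ∷ B)  e = ⁻¹-cong (wedge-cong i _ _ B (λ B′ → e (inside ∷ B′)))

  wedge-∙ : ∀ i (X Y : Form n) B → wedge i (λ B′ → X B′ ∙ Y B′) B ≈ wedge i X B ∙ wedge i Y B
  wedge-∙ zero    X Y (outside ∷ B) = sym (identityˡ ε)
  wedge-∙ zero    X Y (inside ∷ B)  = refl
  wedge-∙ (suc i) X Y (outside ∷ B) = wedge-∙ i _ _ B
  wedge-∙ (suc i) X Y (inside ∷ B)  = trans (⁻¹-cong (wedge-∙ i _ _ B)) (sym (⁻¹-∙-comm _ _))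

  wedge-⁻¹ : ∀ i (X : Form n) B → wedge i (λ B′ → X B′ ⁻¹) B ≈ wedge i X B ⁻¹
  wedge-⁻¹ zero    X (outside ∷ B) = sym ε⁻¹≈ε
  wedge-⁻¹ zero    X (inside ∷ B)  = refl
  wedge-⁻¹ (suc i) X (outside ∷ B) = wedge-⁻¹ i _ B
  wedge-⁻¹ (suc i) X (inside ∷ B)  = ⁻¹-cong (wedge-⁻¹ i _ B)

  wedge-ε : ∀ (j : Fin n) B → wedge j (λ _ → ε) B ≈ ε
  wedge-ε zero    (outside ∷ B) = refl
  wedge-ε zero    (inside ∷ B)  = refl
  wedge-ε (suc j) (outside ∷ B) = wedge-ε j B
  wedge-ε (suc j) (inside ∷ B)  = ⁻¹-zero (wedge-ε j B)

  wedge-anticomm : ∀ i j (X : Form n) B → wedge i (wedge j X) B ≈ wedge j (wedge i X) B ⁻¹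
  wedge-anticomm zero    zero    X (outside ∷ B) = sym ε⁻¹≈ε
  wedge-anticomm zero    zero    X (inside ∷ B)  = sym ε⁻¹≈ε
  wedge-anticomm zero    (suc j) X (outside ∷ B) = sym (⁻¹-zero (wedge-ε j B))
  wedge-anticomm zero    (suc j) X (inside ∷ B)  = sym (⁻¹-involutive _)
  wedge-anticomm (suc i) zero    X (outside ∷ B) = trans (wedge-ε i B) (sym ε⁻¹≈ε)
  wedge-anticomm (suc i) zero    X (inside ∷ B)  = refl
  wedge-anticomm (suc i) (suc j) X (outside ∷ B) = wedge-anticomm i j _ B
  wedge-anticomm (suc i) (suc j) X (inside ∷ B)  = ⁻¹-cong (begin
    wedge i (λ B′ → wedge j (X ∘ (inside ∷_)) B′ ⁻¹) B  ≈⟨ wedge-⁻¹ i _ B ⟩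
    wedge i (wedge j (X ∘ (inside ∷_))) B ⁻¹            ≈⟨ ⁻¹-cong (wedge-anticomm i j _ B) ⟩
    wedge j (wedge i (X ∘ (inside ∷_))) B ⁻¹ ⁻¹         ≈⟨ ⁻¹-cong (wedge-⁻¹ j _ B) ⟨
    wedge j (λ B′ → wedge i (X ∘ (inside ∷_)) B′ ⁻¹) B ⁻¹ ∎)

  -- Up to sign the value is that of `X` at `B` without `i`; the implication hides the sign. The
  -- alternative is settled by the shape of `B`, not by values of `X`.
  wedge-support : ∀ i (X : Form n) B →
    wedge i X B ≈ ε ⊎ (i ∈ˢ B × (X (B [ i ]≔ outside) ≈ ε → wedge i X B ≈ ε))
  wedge-support zero    X (outside ∷ B) = inj₁ refl
  wedge-support zero    X (inside ∷ B)  = inj₂ (here , λ z → z)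
  wedge-support (suc i) X (outside ∷ B) with wedge-support i (X ∘ (outside ∷_)) B
  ... | inj₁ z       = inj₁ z
  ... | inj₂ (p , f) = inj₂ (there p , f)
  wedge-support (suc i) X (inside ∷ B) with wedge-support i (X ∘ (inside ∷_)) B
  ... | inj₁ z       = inj₁ (⁻¹-zero z)
  ... | inj₂ (p , f) = inj₂ (there p , λ z → ⁻¹-zero (f z))

  -- Contraction is an antiderivation, and its functional takes the generator `i` to 1.
  ι-wedge : ∀ i (X : Form n) B → ι (wedge i X) B ≈ X B - wedge i (ι X) B
  ι-wedge zero    X (outside ∷ B) = trans (∙-congˡ (ι-zero _ B (λ _ → refl)))
                                      (trans (identityʳ _) (sym (x-ε _)))
  ι-wedge zero    X (inside ∷ B)  = begin
    ι (X ∘ (outside ∷_)) B ⁻¹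
      ≈⟨ identityˡ _ ⟨
    ε - ι (X ∘ (outside ∷_)) B
      ≈⟨ ∙-congʳ (inverseʳ _) ⟨
    (X (inside ∷ B) - X (inside ∷ B)) - ι (X ∘ (outside ∷_)) B
      ≈⟨ assoc _ _ _ ⟩
    X (inside ∷ B) ∙ (X (inside ∷ B) ⁻¹ - ι (X ∘ (outside ∷_)) B)
      ≈⟨ ∙-congˡ (⁻¹-∙-comm _ _) ⟩
    X (inside ∷ B) - ι X (outside ∷ B) ∎
  ι-wedge (suc i) X (outside ∷ B) = begin
    wedge i (X ∘ (inside ∷_)) B ⁻¹ ∙ ι (wedge i (X ∘ (outside ∷_))) B
      ≈⟨ ∙-congˡ (ι-wedge i _ B) ⟩
    wedge i (X ∘ (inside ∷_)) B ⁻¹ ∙ (X (outside ∷ B) - wedge i (ι (X ∘ (outside ∷_))) B)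
      ≈⟨ assoc _ _ _ ⟨
    (wedge i (X ∘ (inside ∷_)) B ⁻¹ ∙ X (outside ∷ B)) - wedge i (ι (X ∘ (outside ∷_))) B
      ≈⟨ ∙-congʳ (comm _ _) ⟩
    (X (outside ∷ B) - wedge i (X ∘ (inside ∷_)) B) - wedge i (ι (X ∘ (outside ∷_))) B
      ≈⟨ assoc _ _ _ ⟩
    X (outside ∷ B) ∙ (wedge i (X ∘ (inside ∷_)) B ⁻¹ - wedge i (ι (X ∘ (outside ∷_))) B)
      ≈⟨ ∙-congˡ (⁻¹-∙-comm _ _) ⟩
    X (outside ∷ B) - (wedge i (X ∘ (inside ∷_)) B ∙ wedge i (ι (X ∘ (outside ∷_))) B)
      ≈⟨ ∙-congˡ (⁻¹-cong (wedge-∙ i _ _ B)) ⟨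
    X (outside ∷ B) - wedge i (λ B′ → ι X (outside ∷ B′)) B ∎
  ι-wedge (suc i) X (inside ∷ B)  = begin
    ι (λ B′ → wedge i (X ∘ (inside ∷_)) B′ ⁻¹) B ⁻¹
      ≈⟨ ⁻¹-cong (ι-⁻¹ _ B) ⟩
    ι (wedge i (X ∘ (inside ∷_))) B ⁻¹ ⁻¹
      ≈⟨ ⁻¹-involutive _ ⟩
    ι (wedge i (X ∘ (inside ∷_))) B
      ≈⟨ ι-wedge i _ B ⟩
    X (inside ∷ B) - wedge i (ι (X ∘ (inside ∷_))) B
      ≈⟨ ∙-congˡ (wedge-⁻¹ i _ B) ⟨
    X (inside ∷ B) ∙ wedge i (λ B′ → ι X (inside ∷ B′)) B
      ≈⟨ ∙-congˡ (⁻¹-involutive _) ⟨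
    X (inside ∷ B) - wedge i (λ B′ → ι X (inside ∷ B′)) B ⁻¹ ∎

  ∑ : Form n → Carrier
  ∑ {zero}  f = f []
  ∑ {suc n} f = ∑ (f ∘ (outside ∷_)) ∙ ∑ (f ∘ (inside ∷_))

  ∑-cong : ∀ {f g : Form n} → (∀ B → f B ≈ g B) → ∑ f ≈ ∑ g
  ∑-cong {zero}  e = e []
  ∑-cong {suc n} e = ∙-cong (∑-cong (λ B → e (outside ∷ B))) (∑-cong (λ B → e (inside ∷ B)))

  ∑-zero : ∀ {f : Form n} → (∀ B → f B ≈ ε) → ∑ f ≈ ε
  ∑-zero {zero}  z = z []
  ∑-zero {suc n} z = ∙-zero (∑-zero (λ B → z (outside ∷ B))) (∑-zero (λ B → z (inside ∷ B)))

  ∑-∙ : ∀ (f g : Form n) → ∑ (λ B → f B ∙ g B) ≈ ∑ f ∙ ∑ g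
  ∑-∙ {zero}  f g = refl
  ∑-∙ {suc n} f g = trans (∙-cong (∑-∙ {n} _ _) (∑-∙ {n} _ _)) (interchange _ _ _ _)

  ∑-⁻¹ : ∀ (f : Form n) → ∑ (λ B → f B ⁻¹) ≈ ∑ f ⁻¹
  ∑-⁻¹ {zero}  f = refl
  ∑-⁻¹ {suc n} f = trans (∙-cong (∑-⁻¹ {n} _) (∑-⁻¹ {n} _)) (⁻¹-∙-comm _ _)

  ∑-sub : ∀ (f g : Form n) → ∑ (λ B → f B - g B) ≈ ∑ f - ∑ g
  ∑-sub f g = trans (∑-∙ f _) (∙-congˡ (∑-⁻¹ g))

  ∑-bottom : ∀ {f : Form n} → (∀ B → 0 < ∣ B ∣ → f B ≈ ε) → ∑ f ≈ f ⊥
  ∑-bottom {zero}  z = refl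
  ∑-bottom {suc n} z =
    trans (∙-cong (∑-bottom (λ B → z (outside ∷ B)))
                  (∑-zero (λ B → z (inside ∷ B) (s≤s z≤n)))) (identityʳ _)

  ∑-top : ∀ {f : Form n} → (∀ B → ∣ B ∣ < n → f B ≈ ε) → ∑ f ≈ f ⊤
  ∑-top {zero}  z = refl
  ∑-top {suc n} z =
    trans (∙-cong (∑-zero (λ B → z (outside ∷ B) (s≤s (∣p∣≤n B))))
                  (∑-top (λ B p → z (inside ∷ B) (s<s p)))) (identityˡ _)

  -- Cyclicity of the trace. Both sides sum `Ψ` at `(∅ , A)` and `A ∪ j` over the pairs of a set `A`
  -- and a colour `j` outside it; the sign in both depends on how many elements of `A` precede `j`.
  ∑-ι : (Ψ : Marking n → Form n) →
        ∑ (λ A → ι (Ψ (choosing A)) A) ≈ ∑ (λ A → δ (λ w → Ψ w A) (choosing A))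
  ∑-ι {zero}  Ψ = refl
  ∑-ι {suc n} Ψ = begin
    ∑ (λ A → x A ∙ ι (Y (choosing A)) A) ∙ ∑ (λ A → ι (Z (choosing A)) A ⁻¹)
      ≈⟨ ∙-cong (∑-∙ x _) (∑-⁻¹ {n} _) ⟩
    (∑ x ∙ ∑ (λ A → ι (Y (choosing A)) A)) - ∑ (λ A → ι (Z (choosing A)) A)
      ≈⟨ ∙-cong (trans (∙-congˡ (∑-ι Y)) (comm _ _)) (⁻¹-cong (∑-ι Z)) ⟩
    (∑ (λ A → δ (λ w → Y w A) (choosing A)) ∙ ∑ x) - ∑ (λ A → δ (λ w → Z w A) (choosing A))
      ≈⟨ assoc _ _ _ ⟩
    ∑ (λ A → δ (λ w → Y w A) (choosing A)) ∙ (∑ x - ∑ (λ A → δ (λ w → Z w A) (choosing A)))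
      ≈⟨ ∙-congˡ (∑-sub {n} _ _) ⟨
    ∑ (λ A → δ (λ w → Y w A) (choosing A)) ∙ ∑ (λ A → x A - δ (λ w → Z w A) (choosing A)) ∎
    where
    x : Form n
    x A = Ψ (settled outside ∷ choosing A) (inside ∷ A)
    Y Z : Marking n → Form n
    Y w B = Ψ (settled outside ∷ w) (outside ∷ B)
    Z w B = Ψ (chosen ∷ w) (inside ∷ B)

  -- Induction on q: the equation at the markings with 0 ∈ T, summed over the diagonal, trades T ∋ 0
  -- and T ∌ 0 for 0 ∈ S.
  trace : ∀ q (P : Marking n → Form n) u → q ≤ n →
          (∀ w B {i} → i ∈ˢ S-of w → i ∈ˢ B → P w B ≈ ε) →
          (∀ w B → ι (P w) B ∙ δ (λ w′ → P w′ B) w ≈ κ (λ w′ → P w′ B) w) →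
          (∀ w → #S w ≡ q → #T w ≡ 0 → P w ⊥ ≈ u) →
          (∀ w B → #S w ≡ q → 0 < ∣ B ∣ → P w B ≈ ε) →
          ∑ (λ A → P (choosing A) A) ≈ u
  trace {n} zero P u _ sup eq base off = trans
    (∑-bottom λ A → off (choosing A) A (≡.trans (cong ∣_∣ (S-choosing A)) (∣⊥∣≡0 n)))
    (base (choosing ⊥) (≡.trans (cong ∣_∣ (S-choosing {n} ⊥)) (∣⊥∣≡0 n))
                       (≡.trans (cong ∣_∣ (T-choosing {n} ⊥)) (∣⊥∣≡0 n)))
  trace {suc n} (suc q) P u (s≤s q≤n) sup eq base off = begin
    ∑ x ∙ ∑ y
      ≈⟨ comm _ _ ⟩
    ∑ y ∙ ∑ x
      -- Inserts the two sides of `∑-ι Y` with opposite signs, which completes the left-hand side of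
      -- `eq` below.
      ≈⟨ cancel-middle ⟩
    (∑ y ∙ ∑ (λ A → ι (Y (choosing A)) A)) ∙ (∑ x - ∑ (λ A → δ (λ w → Y w A) (choosing A)))
      ≈⟨ ∙-cong (∑-∙ {n} _ _) (∑-sub {n} _ _) ⟨
    ∑ (λ A → y A ∙ ι (Y (choosing A)) A) ∙ ∑ (λ A → x A - δ (λ w → Y w A) (choosing A))
      ≈⟨ ∑-∙ {n} _ _ ⟨
    ∑ (λ A → (y A ∙ ι (Y (choosing A)) A) ∙ (x A - δ (λ w → Y w A) (choosing A)))
      -- With colour 0 chosen and absent from the set, `ι` contributes `y` and `δ` contributes `x`,
      -- besides their recursive parts.
      ≈⟨ ∑-cong (λ A → eq (chosen ∷ choosing A) (outside ∷ A)) ⟩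
    ∑ (λ A → P′ (choosing A) A - κ (λ w → Y w A) (choosing A))
      -- Every step of `κ` from `choosing A` excludes a colour of `A`, so `sup` applies.
      ≈⟨ ∑-cong (λ A → trans (//-cong refl (move-zero inside _ (choosing A) (avoids A))) (x-ε _)) ⟩
    ∑ (λ A → P′ (choosing A) A)
      ≈⟨ trace q P′ u q≤n
           (λ w B i∈S i∈B → sup _ _ (there i∈S) (there i∈B))
           -- The term of `ι` that adds colour 0 to `B` vanishes, as that colour is excluded.
           (λ w B → trans (∙-congʳ (sym (trans (∙-congʳ (sup _ _ here here)) (identityˡ _))))
                          (eq (settled inside ∷ w) (outside ∷ B)))
           (λ w p r → base (settled inside ∷ w) (cong suc p) r)
           (λ w B p r → off (settled inside ∷ w) (outside ∷ B) (cong suc p) r) ⟩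
    u ∎
    where
    x y : Form n
    x A = P (settled outside ∷ choosing A) (outside ∷ A)
    y A = P (chosen ∷ choosing A) (inside ∷ A)
    Y P′ : Marking n → Form n
    Y w B = P (chosen ∷ w) (outside ∷ B)
    P′ w B = P (settled inside ∷ w) (outside ∷ B)
    avoids : ∀ A {w} → choosing A ⟶[ inside ] w → Y w A ≈ ε
    avoids A s with i , i∈T , i∈S ← exclude-∈ s =
      sup _ _ (there i∈S) (there (≡.subst (i ∈ˢ_) (T-choosing A) i∈T))
    cancel-middle : ∑ y ∙ ∑ x ≈ (∑ y ∙ ∑ (λ A → ι (Y (choosing A)) A)) ∙
                               (∑ x - ∑ (λ A → δ (λ w → Y w A) (choosing A)))
    cancel-middle = sym (begin
      (∑ y ∙ ∑ (λ A → ι (Y (choosing A)) A)) ∙ (∑ x - ∑ (λ A → δ (λ w → Y w A) (choosing A)))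
        ≈⟨ interchange _ _ _ _ ⟩
      (∑ y ∙ ∑ x) ∙ (∑ (λ A → ι (Y (choosing A)) A) - ∑ (λ A → δ (λ w → Y w A) (choosing A)))
        ≈⟨ ∙-congˡ (x≈y⇒x∙y⁻¹≈ε (∑-ι Y)) ⟩
      (∑ y ∙ ∑ x) ∙ ε
        ≈⟨ identityʳ _ ⟩
      ∑ y ∙ ∑ x ∎)

remove-⊆ : ∀ (B : Subset N) i {j} → j ∈ˢ (B [ i ]≔ outside) → j ∈ˢ B
remove-⊆ (_ ∷ B) zero    (there j∈) = there j∈
remove-⊆ (_ ∷ B) (suc i) here       = here
remove-⊆ (_ ∷ B) (suc i) (there j∈) = there (remove-⊆ B i j∈)

remove-∉ : ∀ (B : Subset N) i → i ∉ˢ (B [ i ]≔ outside)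
remove-∉ B i i∈ with () ← []=-injective i∈ ([]≔-updates B i)

-- Oriented chains as an abelian group.

module Chains (𝔽 : HeytingField c ℓ₁ ℓ₂) (V : Set v) where
  open HeytingField 𝔽 using (heytingCommutativeRing)
  open CommutativeRing (HeytingCommutativeRing.commutativeRing heytingCommutativeRing) hiding (zero)
  open import Algebra.Properties.AbelianGroup +-abelianGroup using (⁻¹-∙-comm; ε⁻¹≈ε)
  open Homology 𝔽 V

  neg : Chain n → Chain n
  neg = map (λ (b , σ) → - b , σ)

  ≋-reflexive : {z w : Chain n} → z ≡ w → z ≋ w
  ≋-reflexive ≡.refl = ≋-refl

  ++-congʳ : ∀ (z : Chain n) {w w′} → w ≋ w′ → z ++ w ≋ z ++ w′
  ++-congʳ []      p = p
  ++-congʳ (_ ∷ z) p = ∷-cong refl (++-congʳ z p)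

  ++-congˡ : ∀ {z z′ : Chain n} w → z ≋ z′ → z ++ w ≋ z′ ++ w
  ++-congˡ w ≋-refl        = ≋-refl
  ++-congˡ w (≋-sym p)     = ≋-sym (++-congˡ w p)
  ++-congˡ w (≋-trans p r) = ≋-trans (++-congˡ w p) (++-congˡ w r)
  ++-congˡ w (∷-cong e p)  = ∷-cong e (++-congˡ w p)
  ++-congˡ w exchange      = exchange
  ++-congˡ w merge         = merge
  ++-congˡ w drop          = drop
  ++-congˡ w (orient t)    = orient t

  ++-cong : ∀ {z z′ w w′ : Chain n} → z ≋ z′ → w ≋ w′ → z ++ w ≋ z′ ++ w′
  ++-cong {z′ = z′} {w = w} p r = ≋-trans (++-congˡ w p) (++-congʳ z′ r)

  ++-shift : ∀ t (w z : Chain n) → t ∷ (w ++ z) ≋ w ++ (t ∷ z)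
  ++-shift t []      z = ≋-refl
  ++-shift t (u ∷ w) z = ≋-trans exchange (∷-cong refl (++-shift t w z))

  ++-comm : ∀ (z w : Chain n) → z ++ w ≋ w ++ z
  ++-comm []      w = ≋-reflexive (≡.sym (++-identityʳ w))
  ++-comm (t ∷ z) w = ≋-trans (∷-cong refl (++-comm z w)) (++-shift t w z)

  neg-inverse : ∀ (z : Chain n) → z ++ neg z ≋ []
  neg-inverse []            = ≋-refl
  neg-inverse ((b , σ) ∷ z) = ≋-trans (∷-cong refl (≋-sym (++-shift _ z (neg z))))
    (≋-trans merge (≋-trans (∷-cong (-‿inverseʳ b) ≋-refl) (≋-trans drop (neg-inverse z))))

  neg-cong : ∀ {z w : Chain n} → z ≋ w → neg z ≋ neg w
  neg-cong ≋-refl        = ≋-refl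
  neg-cong (≋-sym p)     = ≋-sym (neg-cong p)
  neg-cong (≋-trans p r) = ≋-trans (neg-cong p) (neg-cong r)
  neg-cong (∷-cong e p)  = ∷-cong (-‿cong e) (neg-cong p)
  neg-cong exchange      = exchange
  neg-cong merge         = ≋-trans merge (∷-cong (⁻¹-∙-comm _ _) ≋-refl)
  neg-cong drop          = ≋-trans (∷-cong ε⁻¹≈ε ≋-refl) drop
  neg-cong (orient t)    = orient t

  chainGroup : ℕ → AbelianGroup _ _
  chainGroup n = record
    { Carrier = Chain n
    ; _≈_ = _≋_
    ; _∙_ = _++_
    ; ε = []
    ; _⁻¹ = neg
    ; isAbelianGroup = record
      { isGroup = record
        { isMonoid = record
          { isSemigroup = record
            { isMagma = record
              { isEquivalence = record { refl = ≋-refl ; sym = ≋-sym ; trans = ≋-trans }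
              ; ∙-cong = ++-cong }
            ; assoc = λ x y z → ≋-reflexive (++-assoc x y z) }
          ; identity = (λ _ → ≋-refl) , λ z → ≋-reflexive (++-identityʳ z) }
        ; inverse = (λ z → ≋-trans (++-comm (neg z) z) (neg-inverse z)) , neg-inverse
        ; ⁻¹-cong = neg-cong }
      ; comm = ++-comm } }

  infixl 6 _⊖_
  _⊖_ : Chain n → Chain n → Chain n
  z ⊖ w = z ++ neg w

  scale-neg : ∀ b (z : Chain n) → scale (- b) z ≋ neg (scale b z)
  scale-neg b []            = ≋-refl
  scale-neg b ((x , σ) ∷ z) = ∷-cong (sym (-‿distribˡ-* b x)) (scale-neg b z)
    where open import Algebra.Properties.Ring ring using (-‿distribˡ-*)

  ∂-++ : ∀ (z w : Chain (suc n)) → ∂ (z ++ w) ≋ ∂ z ++ ∂ w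
  ∂-++ []            w = ≋-refl
  ∂-++ ((b , σ) ∷ z) w = ≋-trans (++-congʳ (scale b (∂-tuple σ)) (∂-++ z w))
    (≋-sym (≋-reflexive (++-assoc (scale b (∂-tuple σ)) (∂ z) (∂ w))))

  ∂-neg : ∀ (z : Chain (suc n)) → ∂ (neg z) ≋ neg (∂ z)
  ∂-neg []            = ≋-refl
  ∂-neg ((b , σ) ∷ z) = ≋-trans (++-cong (scale-neg b (∂-tuple σ)) (∂-neg z))
    (≋-reflexive (≡.sym (map-++ _ (scale b (∂-tuple σ)) (∂ z))))

  ∂-⊖ : ∀ (z w : Chain (suc n)) → ∂ (z ⊖ w) ≋ ∂ z ⊖ ∂ w
  ∂-⊖ z w = ≋-trans (∂-++ z (neg w)) (++-congʳ (∂ z) (∂-neg w))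

  ⊖-ChainOf : ∀ (L : SimplicialComplex V s) {z w : Chain n} →
              z ChainOf L → w ChainOf L → (z ⊖ w) ChainOf L
  ⊖-ChainOf L p r = ++⁺ p (map⁺ r)
    where open import Data.List.Relation.Unary.All.Properties using (++⁺; map⁺)

-- Counting simplices by their colours.

module Counting (𝔽 : HeytingField c ℓ₁ ℓ₂) {V : Set v} {N} (colour : V → Fin N) where
  open HeytingField 𝔽 using (heytingCommutativeRing)
  open CommutativeRing (HeytingCommutativeRing.commutativeRing heytingCommutativeRing) hiding (zero)
  open import Algebra.Properties.Ring ring using (-‿distribˡ-*; -‿distribʳ-*)
  open import Algebra.Properties.AbelianGroup +-abelianGroup
    using (⁻¹-∙-comm; ε⁻¹≈ε; ⁻¹-involutive)
  open import Relation.Binary.Reasoning.Setoid setoid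
  open Homology 𝔽 V
  open Chains 𝔽 V
  open Differences +-abelianGroup using (x-ε; ∙-zero; ⁻¹-zero)
  open Forms +-abelianGroup

  unit : ∀ {n} → Form n
  unit []            = 1#
  unit (outside ∷ B) = unit B
  unit (inside ∷ B)  = 0#

  -- The coordinate at B is the signature of the colours of a tuple whose colours are the elements
  -- of B, without repetition, and 0 for any other tuple.
  form : Vec V n → Form N
  form []      = unit
  form (x ∷ σ) = wedge (colour x) (form σ)

  -- The map induced by `colour` into the oriented chains of the full simplex on the colours, seen
  -- as an exterior algebra. Tuples that repeat a colour go to zero.
  count : Chain n → Form N
  count []            B = 0#
  count ((b , σ) ∷ z) B = b * form σ B + count z B

  ι-scale : ∀ {n} b (X : Form n) B → ι (λ B′ → b * X B′) B ≈ b * ι X B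
  ι-scale b X []            = sym (zeroʳ b)
  ι-scale b X (outside ∷ B) = trans (+-congˡ (ι-scale b _ B)) (sym (distribˡ b _ _))
  ι-scale b X (inside ∷ B)  = trans (-‿cong (ι-scale b _ B)) (-‿distribʳ-* b _)

  wedge-scale : ∀ {n} i b (X : Form n) B → wedge i (λ B′ → b * X B′) B ≈ b * wedge i X B
  wedge-scale zero    b X (outside ∷ B) = sym (zeroʳ b)
  wedge-scale zero    b X (inside ∷ B)  = refl
  wedge-scale (suc i) b X (outside ∷ B) = wedge-scale i b _ B
  wedge-scale (suc i) b X (inside ∷ B)  =
    trans (-‿cong (wedge-scale i b _ B)) (-‿distribʳ-* b _)

  ι-unit : ∀ {n} (B : Subset n) → ι unit B ≈ 0#
  ι-unit []            = refl
  ι-unit (outside ∷ B) = ∙-zero refl (ι-unit B)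
  ι-unit (inside ∷ B)  = ⁻¹-zero (ι-zero _ B (λ _ → refl))

  unit-⊥ : ∀ n → unit (⊥ {n}) ≈ 1#
  unit-⊥ zero    = refl
  unit-⊥ (suc n) = unit-⊥ n

  -- This makes `count` respect the relation `orient`.
  form-swap : ∀ {σ τ : Vec V n} → σ ⇄ τ → ∀ B → form σ B ≈ - form τ B
  form-swap (here {x = x} {y} {xs})    B = wedge-anticomm (colour x) (colour y) (form xs) B
  form-swap (there {x = x} {ys = τ} t) B = trans (wedge-cong (colour x) _ _ B (form-swap t))
                                             (wedge-⁻¹ (colour x) (form τ) B)

  count-cong : ∀ {z w : Chain n} → z ≋ w → ∀ B → count z B ≈ count w B
  count-cong ≋-refl        B = refl
  count-cong (≋-sym p)     B = sym (count-cong p B)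
  count-cong (≋-trans p r) B = trans (count-cong p B) (count-cong r B)
  count-cong (∷-cong e p)  B = +-cong (*-congʳ e) (count-cong p B)
  count-cong exchange      B = x∙yz≈y∙xz _ _ _
    where open import Algebra.Properties.CommutativeSemigroup +-commutativeSemigroup
  count-cong merge         B = trans (sym (+-assoc _ _ _)) (+-congʳ (sym (distribʳ _ _ _)))
  count-cong drop          B = trans (+-congʳ (zeroˡ _)) (+-identityˡ _)
  count-cong (orient {a = b} {σ} {τ} t) B = +-congʳ (begin
    b * form σ B       ≈⟨ *-congˡ (form-swap t B) ⟩
    b * (- form τ B)   ≈⟨ -‿distribʳ-* b _ ⟨
    - (b * form τ B)   ≈⟨ -‿distribˡ-* b _ ⟩
    (- b) * form τ B   ∎)

  count-++ : ∀ (z w : Chain n) B → count (z ++ w) B ≈ count z B + count w B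
  count-++ []      w B = sym (+-identityˡ _)
  count-++ (t ∷ z) w B = trans (+-congˡ (count-++ z w B)) (sym (+-assoc _ _ _))

  count-neg : ∀ (z : Chain n) B → count (neg z) B ≈ - count z B
  count-neg []            B = sym ε⁻¹≈ε
  count-neg ((b , σ) ∷ z) B =
    trans (+-cong (sym (-‿distribˡ-* b _)) (count-neg z B)) (⁻¹-∙-comm _ _)

  count-⊖ : ∀ (z w : Chain n) B → count (z ⊖ w) B ≈ count z B - count w B
  count-⊖ z w B = trans (count-++ z (neg w) B) (+-congˡ (count-neg w B))

  count-scale : ∀ b (z : Chain n) B → count (scale b z) B ≈ b * count z B
  count-scale b []            B = sym (zeroʳ b)
  count-scale b ((x , σ) ∷ z) B =
    trans (+-cong (*-assoc b x _) (count-scale b z B)) (sym (distribˡ b _ _))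

  count-zero : ∀ {z : Chain n} {B} → All (λ (b , σ) → form σ B ≈ 0#) z → count z B ≈ 0#
  count-zero []      = refl
  count-zero (e ∷ p) = ∙-zero (trans (*-congˡ e) (zeroʳ _)) (count-zero p)

  -- Treats the faces of `x ∷ σ` that keep `x`: they are cones over faces of `σ`, with the sign
  -- reversed by the shift of position. Arbitrary coefficients `b` let the induction run over the
  -- index.
  count-cone : ∀ {k} x (b : Fin k → Carrier) (σ : Fin k → Vec V n) B →
    count (tabulate (λ i → - b i , x ∷ σ i)) B ≈
    - wedge (colour x) (count (tabulate (λ i → b i , σ i))) B
  count-cone {k = zero}  x b σ B = sym (⁻¹-zero (wedge-ε (colour x) B))
  count-cone {k = suc k} x b σ B = begin
    (- b zero) * w B + count (tabulate (λ i → - b (suc i) , x ∷ σ (suc i))) B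
      ≈⟨ +-cong (sym (-‿distribˡ-* _ _)) (count-cone x (b ∘ suc) (σ ∘ suc) B) ⟩
    - (b zero * w B) - wedge (colour x) r B
      ≈⟨ ⁻¹-∙-comm _ _ ⟩
    - (b zero * w B + wedge (colour x) r B)
      ≈⟨ -‿cong (+-congʳ (wedge-scale (colour x) _ _ B)) ⟨
    - (wedge (colour x) (λ B′ → b zero * form (σ zero) B′) B + wedge (colour x) r B)
      ≈⟨ -‿cong (wedge-∙ (colour x) _ r B) ⟨
    - wedge (colour x) (λ B′ → b zero * form (σ zero) B′ + r B′) B ∎
    where
    w r : Form N
    w = wedge (colour x) (form (σ zero))
    r = count (tabulate (λ i → b (suc i) , σ (suc i)))

  -- Deleting the first vertex and deleting a later one give the two terms of the antiderivation
  -- rule `ι-wedge`.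
  count-faces : ∀ (σ : Vec V (suc n)) B → count (∂-tuple σ) B ≈ ι (form σ) B
  count-faces (x ∷ [])     B = begin
    1# * unit B + 0#                          ≈⟨ +-cong (*-identityˡ _) (sym ε⁻¹≈ε) ⟩
    unit B - 0#                               ≈⟨ +-congˡ (-‿cong (wedge-ε (colour x) B)) ⟨
    unit B - wedge (colour x) (λ _ → 0#) B    ≈⟨ +-congˡ (-‿cong (wedge-cong (colour x) _ _ B ι-unit)) ⟨
    unit B - wedge (colour x) (ι unit) B      ≈⟨ ι-wedge (colour x) unit B ⟨
    ι (wedge (colour x) unit) B               ∎
  count-faces (x ∷ σ@(_ ∷ _)) B = begin
    1# * form σ B + count (tabulate (λ i → - sign (toℕ i) , x ∷ removeAt σ i)) B
      ≈⟨ +-cong (*-identityˡ _) (count-cone x (sign ∘ toℕ) (removeAt σ) B) ⟩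
    form σ B - wedge (colour x) (count (∂-tuple σ)) B
      ≈⟨ +-congˡ (-‿cong (wedge-cong (colour x) _ _ B (count-faces σ))) ⟩
    form σ B - wedge (colour x) (ι (form σ)) B
      ≈⟨ ι-wedge (colour x) (form σ) B ⟨
    ι (form (x ∷ σ)) B ∎

  count-∂ : ∀ (z : Chain (suc n)) B → count (∂ z) B ≈ ι (count z) B
  count-∂ []            B = sym (ι-zero _ B (λ _ → refl))
  count-∂ ((b , σ) ∷ z) B = begin
    count (scale b (∂-tuple σ) ++ ∂ z) B
      ≈⟨ count-++ (scale b (∂-tuple σ)) (∂ z) B ⟩
    count (scale b (∂-tuple σ)) B + count (∂ z) B
      ≈⟨ +-cong (trans (count-scale b (∂-tuple σ) B) (*-congˡ (count-faces σ B))) (count-∂ z B) ⟩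
    b * ι (form σ) B + ι (count z) B
      ≈⟨ +-congʳ (ι-scale b (form σ) B) ⟨
    ι (λ B′ → b * form σ B′) B + ι (count z) B
      ≈⟨ ι-∙ _ (count z) B ⟨
    ι (count ((b , σ) ∷ z)) B ∎

  -- For `B` equal to `⊤` the second component is the colour condition of `IsRainbow`.
  ColouredExactlyBy : Vec V n → Subset N → Set _
  ColouredExactlyBy σ B =
    (∀ {x} → x ∈ toList σ → colour x ∈ˢ B) ×
    (∀ {i} → i ∈ˢ B → ∃! _≡_ (λ x → x ∈ toList σ × colour x ≡ i))

  unit-support : ∀ {n} (B : Subset n) → unit B ≈ 0# ⊎ B ≡ ⊥
  unit-support []            = inj₂ ≡.refl
  unit-support (inside ∷ B)  = inj₁ refl
  unit-support (outside ∷ B) with unit-support B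
  ... | inj₁ z      = inj₁ z
  ... | inj₂ ≡.refl = inj₂ ≡.refl

  -- The first vertex uses up its colour, so the others have to be coloured exactly by the rest of
  -- `B`. The case distinction never compares field elements.
  form-support : ∀ (σ : Vec V n) B → form σ B ≈ 0# ⊎ ColouredExactlyBy σ B
  form-support []      B with unit-support B
  ... | inj₁ z      = inj₁ z
  ... | inj₂ ≡.refl = inj₂ ((λ ()) , λ i∈ → ⊥-elim (∉⊥ i∈))
  form-support (x ∷ σ) B with wedge-support (colour x) (form σ) B
  ... | inj₁ z = inj₁ z
  ... | inj₂ (cx∈B , imp) with form-support σ (B [ colour x ]≔ outside)
  ...   | inj₁ z = inj₁ (imp z)
  ...   | inj₂ (into , onto) = inj₂ (into′ , onto′)
    where
    fresh : ∀ {y} → y ∈ toList σ → colour y ≢ colour x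
    fresh {y} y∈ e = remove-∉ B (colour x) (≡.subst (_∈ˢ (B [ colour x ]≔ outside)) e (into y∈))
    into′ : ∀ {y} → y ∈ toList (x ∷ σ) → colour y ∈ˢ B
    into′ (Any.here ≡.refl) = cx∈B
    into′ (Any.there y∈)    = remove-⊆ B (colour x) (into y∈)
    onto′ : ∀ {i} → i ∈ˢ B → ∃! _≡_ (λ y → y ∈ toList (x ∷ σ) × colour y ≡ i)
    onto′ {i} i∈B with i Fin.≟ colour x
    ... | yes ≡.refl = x , (Any.here ≡.refl , ≡.refl) , λ where
      (Any.here e , _)   → ≡.sym e
      (Any.there y∈ , e) → ⊥-elim (fresh y∈ e)
    ... | no i≢cx with y , (y∈ , e) , uniq ← onto ([]≔-minimal B i (colour x) i≢cx i∈B) =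
      y , (Any.there y∈ , e) , λ where
        (Any.here ≡.refl , e′) → ⊥-elim (i≢cx (≡.sym e′))
        (Any.there y∈ , e′)    → uniq (y∈ , e′)

-- Inclusions of complexes.

_⊑_ : {V : Set v} → SimplicialComplex V s → SimplicialComplex V s′ → Set _
K ⊑ L = ∀ {σ} → IsSimplex K σ → IsSimplex L σ

module _ (𝔽 : HeytingField c ℓ₁ ℓ₂) {V : Set v} where
  open Homology 𝔽 V

  ⊑-ChainOf : ∀ {n} {K : SimplicialComplex V s} {L : SimplicialComplex V s′} → K ⊑ L →
               {z : Chain n} → z ChainOf K → z ChainOf L
  ⊑-ChainOf {K = K} {L} K⊑L = All.map λ {(_ , σ)} → oriented σ
    where
    oriented : ∀ {n} (σ : Vec V n) → IsOrientedSimplex K σ → IsOrientedSimplex L σ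
    oriented []      _       = _
    oriented (_ ∷ _) (u , p) = u , K⊑L p

  -- Transfers the homological hypotheses to `carrier`, which describes the same simplices by one
  -- formula for all cases.
  CyclesBound-resp : ∀ n {K : SimplicialComplex V s} {L : SimplicialComplex V s′} →
                     K ⊑ L → L ⊑ K → CyclesBound n K → CyclesBound n L
  CyclesBound-resp n {K} {L} K⊑L L⊑K bound z z∈L cyc
    with w , w∈K , e ← bound z (⊑-ChainOf {K = L} {L = K} L⊑K z∈L) cyc
    = w , ⊑-ChainOf {K = K} {L = L} K⊑L w∈K , e

suc<suc∸ : ∀ {k} m n → k ℕ.< m ∸ n → suc k ℕ.< suc m ∸ n
suc<suc∸ m       zero    p = s<s p
suc<suc∸ (suc m) (suc n) p = suc<suc∸ m n p

-- Construction of the chains E(S , T) by induction on the number of vertices.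

module Construction
  (𝔽 : HeytingField c ℓ₁ ℓ₂) {V : Set v} {r : ℕ} (r<N : r ℕ.< N)
  (carrier : Marking N → SimplicialComplex V s)
  (carrier-move : ∀ {b w w′} → w ⟶[ b ] w′ → carrier w′ ⊑ carrier w)
  (carrier-drop : ∀ {w w′} → w ⟶[ outside ] w′ → 0 ℕ.< #S w → carrier w ⊑ carrier w′)
  (fill : ∀ n w → #S w ≡ r ∸ n → 0 ℕ.< #S w ⊎ #T w ≡ suc n →
          Homology.CyclesBound 𝔽 V n (carrier w))
  where

  open import Data.Nat.Base using (_<_; _≤_)
  open import Data.Nat.Properties
  open Homology 𝔽 V
  open Chains 𝔽 V
  private
    module M {n} = Moves (chainGroup n)
    module D {n} = Differences (chainGroup n)
  open M
  open HeytingField 𝔽 using (1#)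

  []-cycle : ∀ n → IsCycle {n} []
  []-cycle zero    = tt
  []-cycle (suc n) = ≋-refl

  -- The chains E(S , T) with n vertices; here q = suc r.
  record Stage (n : ℕ) : Set (c ⊔ ℓ₁ ⊔ v ⊔ s) where
    field
      E         : Marking N → Chain n
      E-carried : ∀ w → E w ChainOf carrier w
      E-size    : ∀ w → #T w ≢ n → E w ≋ []
      E-below   : ∀ w → #S w < suc r ∸ n → E w ≋ []
      -- Chains with `n + 1` vertices vanish where `#S w` exceeds `r ∸ n`, so their prescribed
      -- boundary has to vanish there.
      𝒟-above   : ∀ w → r ∸ n < #S w → 𝒟 E w ≋ []
      𝒟-cycle   : ∀ w → IsCycle (𝒟 E w)

  module Step (stage : Stage n) where
    open Stage stage

    X : Marking N → Chain n
    X = 𝒟 E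

    moved-carried : ∀ b w → move b E w ChainOf carrier w
    moved-carried b w = move-closed (_ChainOf carrier w) [] (⊖-ChainOf (carrier w)) b E w
      (λ {w′} t → ⊑-ChainOf 𝔽 {K = carrier w′} {L = carrier w} (carrier-move t) (E-carried w′))

    X-carried : ∀ w → X w ChainOf carrier w
    X-carried w = ⊖-ChainOf (carrier w) (moved-carried inside w) (moved-carried outside w)

    X-size : ∀ w → #T w ≢ suc n → X w ≋ []
    X-size w p = 𝒟-zero E w (λ t → E-size _ (small t)) (λ t → E-size _ (small t))
      where
      small : ∀ {b w′} → w ⟶[ b ] w′ → #T w′ ≢ n
      small t e = p (≡.trans (⟶-#T t) (cong suc e))

    X-below : ∀ w → #S w < r ∸ n → X w ≋ []
    X-below w p = 𝒟-zero E w
      (λ t → E-below _ (≡.subst (_< suc r ∸ n) (≡.sym (exclude-#S t)) (suc<suc∸ r n p)))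
      (λ t → E-below _ (≡.subst (_< suc r ∸ n) (≡.sym (cong ∣_∣ (drop-S t)))
                          (<-≤-trans p (∸-monoˡ-≤ n (n≤1+n r)))))

    -- X is closed for δ where |S| = r ∸ n > 0, hence X = δ (h X) there; filling h X rather than X makes
    -- the resulting filling δ F of X closed for δ again.
    cone-fill : ∀ w → ∃[ y ] (y ChainOf carrier w ×
      (#S w ≡ r ∸ n → 0 < #S w → ∂ y ≋ h X w) × (#T w ≢ n → y ≋ []))
    cone-fill w with (#S w ≟ r ∸ n) ×-dec (0 <? #S w) | #T w ≟ n
    ... | no ¬p       | _     = [] , [] , (λ p q → contradiction (p , q) ¬p) , λ _ → ≋-refl
    -- For `T` of the wrong size `h X w` is zero. Choosing the zero filling keeps `δ F` concentrated
    -- on `T` with `n + 1` elements.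
    ... | yes _       | no ¬t = [] , [] , (λ _ _ → ≋-sym (h-closed (_≋ []) ≋-refl X w
        λ {w′} t → X-size w′ λ e → ¬t (suc-injective (≡.trans (≡.sym (⟶-#T t)) e)))) , λ _ → ≋-refl
    -- `h X w` comes from a marking with one more chosen colour; as `S` is nonempty, its carrier is
    -- contained in that of `w`.
    ... | yes (p , q) | yes t =
      let y , y-carried , ∂y = fill n w p (inj₁ q) (h X w)
            (h-closed (_ChainOf carrier w) [] X w λ {w′} t →
               ⊑-ChainOf 𝔽 {K = carrier w′} {L = carrier w}
                 (carrier-drop t (≡.subst (0 <_) (cong ∣_∣ (drop-S t)) q)) (X-carried w′))
            (h-closed IsCycle ([]-cycle n) X w (λ {w′} _ → 𝒟-cycle w′))
      in y , y-carried , (λ _ _ → ∂y) , contradiction t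

    -- Serves the empty `S`. The condition `𝒟-above` of the next stage concerns nonempty `S` only,
    -- so any filling of `X w` will do.
    direct-fill : ∀ w → ∃[ y ] (y ChainOf carrier w ×
      (#S w ≡ r ∸ n → #S w ≡ 0 → ∂ y ≋ X w) × (#T w ≢ suc n → y ≋ []))
    direct-fill w with (#S w ≟ r ∸ n) | #T w ≟ suc n
    ... | no ¬p | _     = [] , [] , (λ p _ → contradiction p ¬p) , λ _ → ≋-refl
    ... | yes _ | no ¬t = [] , [] , (λ _ _ → ≋-sym (X-size w ¬t)) , λ _ → ≋-refl
    ... | yes p | yes t =
      let y , y-carried , ∂y = fill n w p (inj₂ t) (X w) (X-carried w) (𝒟-cycle w)
      in y , y-carried , (λ _ _ → ∂y) , contradiction t

    F : Marking N → Chain (suc n)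
    F w = proj₁ (cone-fill w)

    filling : ∀ w → Dec (#S w ≡ r ∸ n) → Dec (#S w ≡ 0) → Chain (suc n)
    filling w (no _)  _       = []
    filling w (yes _) (yes _) = proj₁ (direct-fill w)
    filling w (yes _) (no _)  = δ F w

    E′ : Marking N → Chain (suc n)
    E′ w = filling w (#S w ≟ r ∸ n) (#S w ≟ 0)

    E′-off : ∀ w → #S w ≢ r ∸ n → E′ w ≋ []
    E′-off w ¬p with #S w ≟ r ∸ n
    ... | no _  = ≋-refl
    ... | yes p = contradiction p ¬p

    E′-δF : ∀ w → #S w ≡ r ∸ n → #S w ≢ 0 → E′ w ≋ δ F w
    E′-δF w p ¬z with #S w ≟ r ∸ n | #S w ≟ 0
    ... | no ¬p | _     = contradiction p ¬p
    ... | yes _ | yes z = contradiction z ¬z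
    ... | yes _ | no _  = ≋-refl

    E′-carried : ∀ w → E′ w ChainOf carrier w
    E′-carried w with #S w ≟ r ∸ n | #S w ≟ 0
    ... | no _  | _     = []
    ... | yes _ | yes _ = proj₁ (proj₂ (direct-fill w))
    ... | yes _ | no _  = move-closed (_ChainOf carrier w) [] (⊖-ChainOf (carrier w)) outside F w
      λ {w′} t → ⊑-ChainOf 𝔽 {K = carrier w′} {L = carrier w} (carrier-move t)
                   (proj₁ (proj₂ (cone-fill w′)))

    E′-size : ∀ w → #T w ≢ suc n → E′ w ≋ []
    E′-size w ¬t with #S w ≟ r ∸ n | #S w ≟ 0
    ... | no _  | _     = ≋-refl
    ... | yes _ | yes _ = proj₂ (proj₂ (proj₂ (direct-fill w))) ¬t
    ... | yes _ | no _  = move-zero outside F w λ {w′} t →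
      proj₂ (proj₂ (proj₂ (cone-fill w′))) λ e → ¬t (≡.trans (⟶-#T t) (cong suc e))

    -- In `𝒟 X`, which is zero, the part `κ X` vanishes by itself: excluding one more colour leads
    -- to where `𝒟-above` applies.
    δX-zero : ∀ w → #S w ≡ r ∸ n → δ X w ≋ []
    δX-zero w p = D.x-y≈ε⇒y≈ε (𝒟-𝒟 E w) (move-zero inside X w λ {w′} t →
      𝒟-above w′ (≡.subst (r ∸ n <_) (≡.sym (≡.trans (exclude-#S t) (cong suc p))) (n<1+n _)))

    ∂E′ : ∀ w → ∂ (E′ w) ≋ X w
    ∂E′ w with #S w ≟ r ∸ n | #S w ≟ 0
    ... | yes p | yes z = proj₁ (proj₂ (proj₂ (direct-fill w))) p z
    ... | no ¬p | _ with <-cmp (#S w) (r ∸ n)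
    ...   | tri< l _ _ = ≋-sym (X-below w l)
    ...   | tri≈ _ p _ = contradiction p ¬p
    ...   | tri> _ _ g = ≋-sym (𝒟-above w g)
    -- Here `∂ (δ F)` equals `δ (h X)`, which is `X - h (δ X)` by the homotopy, and `δ X` is zero on
    -- this level.
    ∂E′ w | yes p | no ¬z =
      ≋-trans (move-homo (chainGroup (suc n)) (chainGroup n) ∂ ≋-refl ∂-⊖ outside F w)
      (≋-trans (move-cong outside (∂ ∘ F) (h X) w λ {w′} t →
        proj₁ (proj₂ (proj₂ (cone-fill w′)))
          (≡.trans (cong ∣_∣ (drop-S t)) p)
          (≡.subst (0 <_) (≡.sym (cong ∣_∣ (drop-S t))) (n≢0⇒n>0 ¬z)))
      (≋-trans (≋-sym (≋-trans
          (++-congʳ (δ (h X) w) (h-closed (_≋ []) ≋-refl (δ X) w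
            (λ {w′} t → δX-zero w′ (≡.trans (≡.sym (cong ∣_∣ (drop-S t))) p))))
          (≋-reflexive (++-identityʳ _))))
      (δ-h X w (≤-<-trans (≤-trans (≤-reflexive p) (m∸n≤m r n)) r<N))))

    -- Excluding a colour moves `S` past the level `r ∸ n`. Dropping one stays on the level of `w`;
    -- if that is `r ∸ n`, then `S` is nonempty, `E′` is `δ F` and `δ` squares to zero.
    E′-𝒟-above : ∀ w → r ∸ suc n < #S w → 𝒟 E′ w ≋ []
    E′-𝒟-above w p = D.//-zero (move-zero inside E′ w κ-off) δ-off
      where
      κ-off : ∀ {w′} → w ⟶[ inside ] w′ → E′ w′ ≋ []
      κ-off {w′} t = E′-off w′ λ e → <⇒≢ (begin-strict
        r ∸ n              ≤⟨ m≤suc-pred (r ∸ n) ⟩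
        suc (pred (r ∸ n)) ≡⟨ cong suc (pred[m∸n]≡m∸[1+n] r n) ⟩
        suc (r ∸ suc n)    <⟨ s<s p ⟩
        suc (#S w)         ≡⟨ exclude-#S t ⟨
        #S w′              ∎) (≡.sym e)
        where
        open ≤-Reasoning
        m≤suc-pred : ∀ m → m ≤ suc (pred m)
        m≤suc-pred zero    = z≤n
        m≤suc-pred (suc m) = ≤-refl
      δ-off : δ E′ w ≋ []
      δ-off with #S w ≟ r ∸ n
      ... | no ¬e = move-zero outside E′ w λ {w′} t →
        E′-off w′ λ e → ¬e (≡.trans (≡.sym (cong ∣_∣ (drop-S t))) e)
      ... | yes e = ≋-trans
        (move-cong outside E′ (δ F) w λ {w′} t →
          E′-δF w′ (≡.trans (cong ∣_∣ (drop-S t)) e)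
            λ z → m<n⇒n≢0 p (≡.trans (≡.sym (cong ∣_∣ (drop-S t))) z))
        (move-move outside F w)

    -- `∂` commutes with the moves, which turns the claim into `𝒟 (𝒟 E) ≋ []`.
    E′-cycle : ∀ w → ∂ (𝒟 E′ w) ≋ []
    E′-cycle w = ≋-trans (∂-⊖ (κ E′ w) (δ E′ w))
      (≋-trans (D.//-cong (∂-move inside) (∂-move outside)) (𝒟-𝒟 E w))
      where
      ∂-move : ∀ b → ∂ (move b E′ w) ≋ move b X w
      ∂-move b = ≋-trans (move-homo (chainGroup (suc n)) (chainGroup n) ∂ ≋-refl ∂-⊖ b E′ w)
        (move-cong b (∂ ∘ E′) X w (λ {w′} _ → ∂E′ w′))

    next : Stage (suc n)
    next = record
      { E         = E′
      ; E-carried = E′-carried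
      ; E-size    = E′-size
      ; E-below   = λ w p → E′-off w (<⇒≢ p)
      ; 𝒟-above   = E′-𝒟-above
      ; 𝒟-cycle   = E′-cycle
      }

  -- Including |S| > q here makes ∂E = 𝒟 E hold at all markings.
  bottom : {P Q : Set} → Dec P → Dec Q → Chain 0
  bottom (yes _) (yes _) = (1# , []) ∷ []
  bottom _       _       = []

  E₀ : Marking N → Chain 0
  E₀ w = bottom (#T w ≟ 0) (r <? #S w)

  E₀-gen : ∀ w → r < #S w → #T w ≡ 0 → E₀ w ≡ (1# , []) ∷ []
  E₀-gen w p t with #T w ≟ 0 | r <? #S w
  ... | yes _ | yes _ = ≡.refl
  ... | no ¬t | _     = contradiction t ¬t
  ... | yes _ | no ¬p = contradiction p ¬p

  initial : Stage 0
  initial = record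
    { E         = E₀
    ; E-carried = carried
    ; E-size    = size
    ; E-below   = below
    ; 𝒟-above   = above
    ; 𝒟-cycle   = λ _ → tt
    }
    where
    carried : ∀ w → E₀ w ChainOf carrier w
    carried w with #T w ≟ 0 | r <? #S w
    ... | yes _ | yes _ = tt ∷ []
    ... | yes _ | no _  = []
    ... | no _  | _     = []
    size : ∀ w → #T w ≢ 0 → E₀ w ≋ []
    size w ¬t with #T w ≟ 0
    ... | yes t = contradiction t ¬t
    ... | no _  = ≋-refl
    below : ∀ w → #S w < suc r → E₀ w ≋ []
    below w p with #T w ≟ 0 | r <? #S w
    ... | yes _ | yes q = contradiction (≤-trans p q) (n≮n _)
    ... | yes _ | no _  = ≋-refl
    ... | no _  | _     = ≋-refl
    gen : ℕ → Chain 0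
    gen zero    = (1# , []) ∷ []
    gen (suc _) = []
    E₀-gen′ : ∀ w k → r < #S w → #T w ≡ k → E₀ w ≋ gen k
    E₀-gen′ w zero    p t = ≋-reflexive (E₀-gen w p t)
    E₀-gen′ w (suc _) p t = size w λ z → 1+n≢0 (≡.trans (≡.sym t) z)
    -- For `S` this large `E₀` depends on `#T` alone, so `κ` and `δ` agree on it and cancel.
    above : ∀ w → r < #S w → 𝒟 E₀ w ≋ []
    above w p = ≋-trans (D.//-cong
      (≋-trans (move-cong inside E₀ (gen ∘ #T) w λ {w′} t →
                  E₀-gen′ w′ _ (≡.subst (r <_) (≡.sym (exclude-#S t)) (m<n⇒m<1+n p)) ≡.refl)
               (move-#T inside outside gen w))
      (move-cong outside E₀ (gen ∘ #T) w λ {w′} t →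
                  E₀-gen′ w′ _ (≡.subst (r <_) (≡.sym (cong ∣_∣ (drop-S t))) p) ≡.refl))
      (neg-inverse (δ (gen ∘ #T) w))

  stage : ∀ n → Stage n
  stage zero    = initial
  stage (suc n) = Step.next (stage n)

  E : ∀ n → Marking N → Chain n
  E n = Stage.E (stage n)

  ∂E : ∀ n w → ∂ (E (suc n) w) ≋ 𝒟 (E n) w
  ∂E n = Step.∂E′ (stage n)

  E-off : ∀ n w → #S w ≢ r ∸ n → E (suc n) w ≋ []
  E-off n = Step.E′-off (stage n)

∉-empty : ∀ {n} {p : Subset n} → ∣ p ∣ ≡ 0 → ∀ {i} → i ∉ˢ p
∉-empty {p = p} e i∈p = ℕ.m<n⇒n≢0 (x∈p⇒∣p-x∣<∣p∣ i∈p) e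

-- Carriers from the hypotheses, and the resulting trace.

module Rainbow
  (𝔽 : HeytingField c ℓ₁ ℓ₂) {V : Set v} (K : SimplicialComplex V s) (m : ℕ)
  (colour : V → Fin (suc m)) {r : ℕ} (r≤m : r ℕ.≤ m)
  (bound-K : Homology.CyclesBound 𝔽 V m K)
  (bound-induced : ∀ S n → 1 ℕ.≤ ∣ S ∣ → ∣ S ∣ ℕ.+ n ≡ r →
                   Homology.CyclesBound 𝔽 V n (induced K colour (∁ S)))
  (bound-avoiding : ∀ S n → ∣ S ∣ ≡ suc n → r ℕ.≤ n → n ℕ.< m →
                    Homology.CyclesBound 𝔽 V n (avoiding K colour S))
  where

  -- K_{Sᶜ} for S nonempty, K̃_T for S empty and T a proper subset of the colours, and otherwise K.
  carrier : Marking (suc m) → SimplicialComplex V (v ⊔ s)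
  carrier w .IsSimplex σ =
    IsSimplex K σ ×
    (∀ {x} → x ∈ σ → colour x ∉ˢ S-of w) ×
    (#S w ≡ 0 → #T w ≢ suc m → ¬ (∀ {i} → i ∈ˢ T-of w → i ∈ map colour σ))
  carrier w .nonempty (p , _) = nonempty K p
  carrier w .face (p , q , t) σ⊆τ σ≢[] =
    face K p σ⊆τ σ≢[] ,
    (λ x∈σ → q (σ⊆τ x∈σ)) ,
    λ e f cover → t e f (λ i∈T → map⁺ colour σ⊆τ (cover i∈T))
    where open import Data.List.Relation.Binary.Subset.Propositional.Properties using (map⁺)

  -- After excluding `j` from `T`, no simplex has colour `j`, so none covers `T`. After dropping
  -- `j`, the smaller set is proper and already fails to be covered.
  carrier-move : ∀ {b w w′} → w ⟶[ b ] w′ → carrier w′ ⊑ carrier w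
  carrier-move {inside} {w} {w′} t {σ} (p , q , _) =
    p , (λ x∈ x∈S → q x∈ (exclude-S t x∈S)) , λ _ _ → uncovered
    where
    uncovered : ¬ (∀ {i} → i ∈ˢ T-of w → i ∈ map colour σ)
    uncovered cover with i , i∈T , i∈S ← exclude-∈ t
                    with x , x∈ , ≡.refl ← ∈-map⁻ colour (cover i∈T) = q x∈ i∈S
  carrier-move {outside} {w} {w′} t (p , q , u) =
    p ,
    (λ x∈ x∈S → q x∈ (≡.subst (_ ∈ˢ_) (≡.sym (drop-S t)) x∈S)) ,
    λ e _ cover → u (≡.trans (cong ∣_∣ (drop-S t)) e)
      (ℕ.<⇒≢ (≡.subst (ℕ._≤ suc m) (⟶-#T t) (∣p∣≤n (T-of w))))
      (λ i∈T → cover (drop-T t i∈T))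

  carrier-drop : ∀ {w w′} → w ⟶[ outside ] w′ → 0 ℕ.< #S w → carrier w ⊑ carrier w′
  carrier-drop t 0<S (p , q , u) =
    p ,
    (λ x∈ x∈S → q x∈ (≡.subst (_ ∈ˢ_) (drop-S t) x∈S)) ,
    λ e → contradiction (≡.trans (≡.sym (cong ∣_∣ (drop-S t))) e) (ℕ.m<n⇒n≢0 0<S)

  -- For nonempty `S` this is hypothesis (1), since `#S w + n` is `r`. For empty `S` it is
  -- hypothesis (2) when `n < m`, and otherwise `T` consists of all colours and the homology of `K`
  -- itself is used.
  fill : ∀ n w → #S w ≡ r ∸ n → 0 ℕ.< #S w ⊎ #T w ≡ suc n →
         Homology.CyclesBound 𝔽 V n (carrier w)
  fill n w e cond with #S w ℕ.≟ 0
  ... | no S≢0 = CyclesBound-resp 𝔽 n {K = induced K colour (∁ (S-of w))} {L = carrier w}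
    (λ (p , q) → p , (λ x∈ → x∈∁p⇒x∉p (q x∈)) , λ z → contradiction z S≢0)
    (λ (p , q , _) → p , λ x∈ → x∉p⇒x∈∁p (q x∈))
    (bound-induced (S-of w) n (ℕ.n≢0⇒n>0 S≢0)
      (≡.trans (cong (ℕ._+ n) e) (ℕ.m∸n+n≡m {r} {n} (ℕ.<⇒≤ (ℕ.m∸n≢0⇒n<m {r} {n} (S≢0 ∘ ≡.trans e))))))
  ... | yes S≡0 with cond
  ...   | inj₁ 0<S = contradiction S≡0 (ℕ.m<n⇒n≢0 0<S)
  ...   | inj₂ T≡ with n ℕ.<? m
  ...     | yes n<m = CyclesBound-resp 𝔽 n {K = avoiding K colour (T-of w)} {L = carrier w}
    (λ (p , u) → p , (λ _ → ∉-empty S≡0) , λ _ _ → u)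
    (λ (p , _ , u) → p , u S≡0 (λ f → ℕ.<⇒≢ (s<s n<m) (≡.trans (≡.sym T≡) f)))
    (bound-avoiding (T-of w) n T≡ (ℕ.m∸n≡0⇒m≤n (≡.trans (≡.sym e) S≡0)) n<m)
  ...     | no n≮m with ≡.refl ← ℕ.≤-antisym (ℕ.s≤s⁻¹ (≡.subst (ℕ._≤ suc m) T≡ (∣p∣≤n (T-of w)))) (ℕ.≮⇒≥ n≮m) =
    CyclesBound-resp 𝔽 n {K = K} {L = carrier w}
      (λ p → p , (λ _ → ∉-empty S≡0) , λ _ f → contradiction T≡ f)
      proj₁ bound-K

  open HeytingField 𝔽 using (heytingCommutativeRing; #-irrefl; invertible⇒#)
  open CommutativeRing (HeytingCommutativeRing.commutativeRing heytingCommutativeRing)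
    hiding (zero)
  open Construction 𝔽 (s≤s r≤m) carrier carrier-move carrier-drop fill
  open Homology 𝔽 V
  open Chains 𝔽 V
  open Counting 𝔽 colour
  open Forms +-abelianGroup
  open Moves +-abelianGroup
  open Differences +-abelianGroup using (//-cong; [x-y]∙y; ∙-zero)
  open import Relation.Binary.Reasoning.Setoid setoid

  -- The difference `1# - 0#` is invertible, so `1#` is apart from `0#`.
  1≉0 : ¬ 1# ≈ 0#
  1≉0 e = #-irrefl e (invertible⇒# (1# , inverse , trans (*-comm _ _) inverse))
    where
    inverse : 1# * (1# - 0#) ≈ 1#
    inverse = trans (*-identityˡ _) (Differences.x-ε +-abelianGroup 1#)

  -- The P(S , T ; B) of the trace argument. A simplex with colours exactly `B`, without repetition,
  -- has `∣ B ∣` vertices, which fixes the chain to count in.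
  matrix : Marking (suc m) → Form (suc m)
  matrix w B = count (E ∣ B ∣ w) B

  matrix-support : ∀ w B {i} → i ∈ˢ S-of w → i ∈ˢ B → matrix w B ≈ 0#
  matrix-support w B {i} i∈S i∈B = count-zero (All.map (λ {t} → zero-form {t = t}) (Stage.E-carried (stage ∣ B ∣) w))
    where
    zero-form : ∀ {n} {t : Carrier × Vec V n} → IsOrientedSimplex (carrier w) (proj₂ t) → form (proj₂ t) B ≈ 0#
    zero-form {t = _ , σ} o with form-support σ B
    ... | inj₁ z          = z
    ... | inj₂ (_ , onto) with onto i∈B
    zero-form {t = _ , _ ∷ _} (_ , _ , q , _) | inj₂ _ | x , (x∈ , ≡.refl) , _ = contradiction i∈S (q x∈)


  matrix-equation : ∀ w B → ι (matrix w) B + δ (λ w′ → matrix w′ B) w ≈ κ (λ w′ → matrix w′ B) w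
  matrix-equation w B = trans (+-congʳ (begin
    ι (matrix w) B
      -- All sets read by `ι` at `B` have size `suc ∣ B ∣`, so a single chain is involved.
      ≈⟨ ι-cong _ _ B (λ B′ e → reflexive (cong (λ k → count (E k w) B′) e)) ⟩
    ι (count (E (suc ∣ B ∣) w)) B
      ≈⟨ count-∂ (E (suc ∣ B ∣) w) B ⟨
    count (∂ (E (suc ∣ B ∣) w)) B
      ≈⟨ count-cong (∂E ∣ B ∣ w) B ⟩
    count (C.𝒟 (E ∣ B ∣) w) B
      ≈⟨ count-⊖ (C.κ (E ∣ B ∣) w) (C.δ (E ∣ B ∣) w) B ⟩
    count (C.κ (E ∣ B ∣) w) B - count (C.δ (E ∣ B ∣) w) B
      ≈⟨ //-cong (count-move inside) (count-move outside) ⟩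
    κ (λ w′ → matrix w′ B) w - δ (λ w′ → matrix w′ B) w ∎))
    ([x-y]∙y _ _)
    where
    module C {n} = Moves (chainGroup n)
    count-move : ∀ b → count (C.move b (E ∣ B ∣) w) B ≈ move b (λ w′ → matrix w′ B) w
    count-move b = move-homo (chainGroup ∣ B ∣) +-abelianGroup (λ z → count z B) refl
                     (λ x y → count-⊖ x y B) b (E ∣ B ∣) w

  -- Chains with at least one vertex live on levels `r ∸ n`, below `suc r`.
  matrix-off : ∀ w B → #S w ≡ suc r → 0 ℕ.< ∣ B ∣ → matrix w B ≈ 0#
  matrix-off w B e = off ∣ B ∣
    where
    off : ∀ n → 0 ℕ.< n → count (E n w) B ≈ 0#
    off (suc n) _ = count-cong (E-off n w (ℕ.1+m≢m∸n n ∘ ≡.trans (≡.sym e))) B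

  matrix-base : ∀ w → #S w ≡ suc r → #T w ≡ 0 → matrix w ⊥ ≈ 1#
  matrix-base w e t = begin
    count (E ∣ ⊥ {suc m} ∣ w) ⊥  ≈⟨ reflexive (cong (λ k → count (E k w) ⊥) (∣⊥∣≡0 (suc m))) ⟩
    count (E₀ w) ⊥               ≈⟨ reflexive (cong (λ z → count z ⊥) (E₀-gen w (ℕ.≤-reflexive (≡.sym e)) t)) ⟩
    1# * unit (⊥ {suc m}) + 0#   ≈⟨ trans (+-identityʳ _) (*-identityˡ _) ⟩
    unit (⊥ {suc m})             ≈⟨ unit-⊥ (suc m) ⟩
    1#                           ∎

  #S-choosing : ∀ A → #S (choosing {suc m} A) ≡ 0
  #S-choosing A = ≡.trans (cong ∣_∣ (S-choosing A)) (∣⊥∣≡0 (suc m))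

  matrix-diagonal : ∀ A → ∣ A ∣ ℕ.< suc m → matrix (choosing A) A ≈ 0#
  matrix-diagonal A A<N = diagonal ∣ A ∣
    where
    zero-form : ∀ {n} {t : Carrier × Vec V (suc n)} →
                IsOrientedSimplex (carrier (choosing A)) (proj₂ t) → form (proj₂ t) A ≈ 0#
    zero-form {t = _ , σ@(_ ∷ _)} (_ , _ , _ , u) with form-support σ A
    ... | inj₁ z          = z
    ... | inj₂ (_ , onto) = ⊥-elim
          (u (#S-choosing A) (ℕ.<⇒≢ (≡.subst (ℕ._< suc m) (cong ∣_∣ (≡.sym (T-choosing A))) A<N)) cover)
      where
      cover : ∀ {i} → i ∈ˢ T-of (choosing A) → i ∈ map colour (toList σ)
      cover i∈T with x , (x∈ , ≡.refl) , _ ← onto (≡.subst (_ ∈ˢ_) (T-choosing A) i∈T) = ∈-map⁺ colour x∈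
    diagonal : ∀ n → count (E n (choosing A)) A ≈ 0#
    -- The empty tuple belongs to every complex, so the carrier gives no information here. Instead
    -- `E₀` vanishes because the empty `S` has fewer than `suc r` elements.
    diagonal zero    = count-cong
      (Stage.E-below (stage 0) (choosing A) (≡.subst (ℕ._< suc r) (≡.sym (#S-choosing A)) (s≤s z≤n))) A
    diagonal (suc n) = count-zero (All.map (λ {t} → zero-form {t = t}) (Stage.E-carried (stage (suc n)) (choosing A)))

  matrix-top : matrix (choosing ⊤) ⊤ ≈ 1#
  matrix-top = trans (sym (∑-top matrix-diagonal))
    (trace (suc r) matrix 1# (s≤s r≤m) matrix-support matrix-equation matrix-base matrix-off)

  -- Searching the terms with `form-support` produces the rainbow simplex itself, without deciding
  -- whether a coefficient is zero.
  count-rainbow : ∀ {n w} (z : Chain (suc n)) → z ChainOf carrier w →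
                  count z ⊤ ≈ 0# ⊎ ∃[ σ ] IsRainbow K colour σ
  count-rainbow []                        _                 = inj₁ refl
  count-rainbow ((_ , σ@(_ ∷ _)) ∷ z) ((_ , p , _) ∷ ps) with form-support σ ⊤
  ... | inj₂ (_ , onto) = inj₂ (toList σ , p , λ i → onto ∈⊤)
  ... | inj₁ σ≈0 with count-rainbow z ps
  ...   | inj₁ z≈0     = inj₁ (∙-zero (trans (*-congˡ σ≈0) (zeroʳ _)) z≈0)
  ...   | inj₂ rainbow = inj₂ rainbow

  rainbow : ∃[ σ ] IsRainbow K colour σ
  rainbow with count-rainbow (E _ (choosing ⊤)) (Stage.E-carried (stage _) (choosing ⊤))
  ... | inj₁ e = contradiction (trans (sym matrix-top) e) 1≉0
  ... | inj₂ σ = σ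

-- Translation from integer degrees to numbers of vertices.

open import Data.Integer.Base using (ℤ; +_; -[1+_]; _+_; _-_; _≤_; 1ℤ; -1ℤ; +≤+; -≤-)
import Data.Integer.Properties as ℤ

H̃-vanishes⇒CyclesBound :
  ∀ (𝔽 : HeytingField c ℓ₁ ℓ₂) {V : Set v} n {d} (K : SimplicialComplex V s) →
  d ≡ + n - 1ℤ → H̃-vanishes d K 𝔽 → Homology.CyclesBound 𝔽 V n K
H̃-vanishes⇒CyclesBound 𝔽 zero    K ≡.refl H = H
H̃-vanishes⇒CyclesBound 𝔽 (suc n) K ≡.refl H = H

theorem14 : ∀ {c ℓ₁ ℓ₂ v s : Level} (𝔽 : HeytingField c ℓ₁ ℓ₂) {V : Set v}
    (K : SimplicialComplex V s) (m : ℕ) (colour : V → Fin (suc m)) →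
    H̃-vanishes (+ m - 1ℤ) K 𝔽 →
    (k : ℤ) → -1ℤ ≤ k → k ≤ + m - 1ℤ →
    (∀ (S : Subset (suc m)) → 1ℤ ≤ + ∣ S ∣ → + ∣ S ∣ ≤ k + 1ℤ →
    H̃-vanishes (k - + ∣ S ∣) (induced K colour (∁ S)) 𝔽) →
    (∀ (S : Subset (suc m)) → k + + 2 ≤ + ∣ S ∣ → + ∣ S ∣ ≤ + m →
    H̃-vanishes (+ ∣ S ∣ - + 2) (avoiding K colour S) 𝔽) →
    ∃[ σ ] IsRainbow K colour σ
theorem14 𝔽 {V} K m colour H k -1≤k k≤m-1 H₁ H₂ = Rainbow.rainbow 𝔽 K m colour r≤m
  (H̃-vanishes⇒CyclesBound 𝔽 m K ≡.refl H)
  (λ S n 1≤S S+n≡r → H̃-vanishes⇒CyclesBound 𝔽 n (induced K colour (∁ S)) (degree₁ S n S+n≡r)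
    (H₁ S (+≤+ 1≤S) (≡.subst (+ ∣ S ∣ ≤_) (≡.sym k+1≡r) (+≤+ (ℕ.m+n≤o⇒m≤o _ (ℕ.≤-reflexive S+n≡r))))))
  (λ S n S≡ r≤n n<m → H̃-vanishes⇒CyclesBound 𝔽 n (avoiding K colour S) (degree₂ S n S≡)
    (H₂ S (≡.subst₂ _≤_ (≡.sym k+2≡) (cong +_ (≡.sym S≡)) (+≤+ (s≤s r≤n)))
          (≡.subst (_≤ + m) (cong +_ (≡.sym S≡)) (+≤+ n<m))))
  where
  -- The natural number `r` is `k + 1`, that is q - 1; the lower bound on `k` makes it exist.
  shift : ∃[ r ] k ≡ + r - 1ℤ
  shift = shift′ k -1≤k
    where
    shift′ : ∀ k → -1ℤ ≤ k → ∃[ r ] k ≡ + r - 1ℤ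
    shift′ (+ k)       _         = suc k , ≡.refl
    shift′ -[1+ zero ] _         = zero , ≡.refl
    shift′ -[1+ suc _ ] (-≤- ())
  r : ℕ
  r = proj₁ shift
  k+1≡r : k + 1ℤ ≡ + r
  k+1≡r = begin
    k + 1ℤ            ≡⟨ cong (_+ 1ℤ) (proj₂ shift) ⟩
    (+ r - 1ℤ) + 1ℤ   ≡⟨ ℤ.+-assoc (+ r) -1ℤ 1ℤ ⟩
    + r + (-1ℤ + 1ℤ)  ≡⟨ ℤ.+-identityʳ (+ r) ⟩
    + r               ∎
    where open ≡.≡-Reasoning
  k+2≡ : k + + 2 ≡ + suc r
  k+2≡ = begin
    k + + 2          ≡⟨ ℤ.+-assoc k 1ℤ 1ℤ ⟨
    (k + 1ℤ) + 1ℤ    ≡⟨ cong (_+ 1ℤ) k+1≡r ⟩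
    + r + 1ℤ         ≡⟨ ℤ.+-comm (+ r) 1ℤ ⟩
    + suc r          ∎
    where open ≡.≡-Reasoning
  r≤m : r ℕ.≤ m
  r≤m = ℤ.drop‿+≤+ (≡.subst₂ _≤_ k+1≡r
    (≡.trans (ℤ.+-assoc (+ m) -1ℤ 1ℤ) (ℤ.+-identityʳ (+ m))) (ℤ.+-monoˡ-≤ 1ℤ k≤m-1))
  degree₁ : ∀ (S : Subset (suc m)) n → ∣ S ∣ ℕ.+ n ≡ r → k - + ∣ S ∣ ≡ + n - 1ℤ
  degree₁ S n e = begin
    k - + t                    ≡⟨ cong (_- + t) (proj₂ shift) ⟩
    (+ r - 1ℤ) - + t           ≡⟨ cong (λ x → (+ x - 1ℤ) - + t) e ⟨
    (+ (t ℕ.+ n) - 1ℤ) - + t   ≡⟨ solve 3 (λ t n o → ((t :+ n) :- o) :- t := n :- o) ≡.refl (+ t) (+ n) 1ℤ ⟩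
    + n - 1ℤ                   ∎
    where
    open ≡.≡-Reasoning
    open import Data.Integer.Solver using (module +-*-Solver)
    open +-*-Solver
    t : ℕ
    t = ∣ S ∣
  degree₂ : ∀ (S : Subset (suc m)) n → ∣ S ∣ ≡ suc n → + ∣ S ∣ - + 2 ≡ + n - 1ℤ
  degree₂ S n e = ≡.trans (cong (λ x → + x - + 2) e) (ℤ.[1+m]⊖[1+n]≡m⊖n n 1)
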